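{- For any constant integer $k>2$, there is a 1-sided error distributed algorithm in the CONGEST model for testing $C_k$-freeness which uses $O(1/\epsilon)$ rounds (the constant hidden in the $O$-notation may depend on $k$, but not on $\epsilon$ or the network graph).
   Context: CONGEST model: the network is an undirected graph $G=(V,E)$ with $n=|V|$ nodes and $m=|E|$ edges, nodes have unique $O(\log n)$-bit identifiers and know $n$; computation is synchronous, and in each round every node may send $O(\log n)$ bits over each incident edge; nodes have private randomness. "Subgraph" means not-necessarily-induced subgraph; $C_k$ is the cycle on $k$ vertices. $G$ is $H$-free if it contains no subgraph isomorphic to $H$. $G$ is $\epsilon$-far from a property if at least $\epsilon|E|$ edges must be added to or removed from $E$ to obtain a graph with the property. Testing $H$-freeness with parameter $0<\epsilon\le 1$ (known to the algorithm): if $G$ is $H$-free then with probability at least $2/3$ all nodes accept; if $G$ is $\epsilon$-far from $H$-free then with probability at least $2/3$ some node rejects. The algorithm has 1-sided error if, whenever $G$ is $H$-free, all nodes accept with probability 1. -}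

module Defs where

open import Data.Bool.Base using (Bool; true; false; T; not; _∨_; _xor_)
open import Data.Bool.ListAction using (all; any)
open import Data.Bool.Properties using (∨-comm)
open import Data.Fin.Base using (Fin; toℕ)
open import Data.Fin.Properties using (toℕ<n; _<?_)
open import Data.Integer.Base using (+_)
open import Data.List.Base using (List; []; _∷_; [_]; length; filterᵇ; allFin; cartesianProduct; cartesianProductWith)
open import Data.Nat.Base using (ℕ; zero; suc; _*_; _^_; _<_; s≤s; NonZero; >-nonZero; z<s; _%_)
open import Data.Nat.DivMod using (m<n⇒m%n≡m; n%n≡0)
open import Data.Nat.Logarithm using (⌈log₂_⌉)
open import Data.Nat.Properties using (m^n≢0; <-trans; <-irrefl; 1+n≢n; m≤n⇒m<n∨m≡n; _≟_)
open import Data.Product.Base using (Σ; ∃; _×_; _,_)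
open import Data.Rational.Base as ℚ using (ℚ; 0ℚ; 1ℚ)
open import Data.Sum.Base using (inj₁; inj₂)
open import Data.Vec.Base as Vec using (Vec; lookup)
open import Data.Vec.Bounded.Base using (Vec≤)
open import Function.Base using (_∘_)
open import Function.Bundles using (_↔_; Inverse)
open import Function.Definitions using (Injective)
open import Relation.Binary.PropositionalEquality using (_≡_; _≢_; refl; sym; trans; cong; cong₂; subst)
open import Relation.Nullary.Decidable using (does; dec-false)
open import Relation.Nullary.Negation using (¬_)

record Graph (n : ℕ) : Set where
  field
    adj    : Fin n → Fin n → Bool
    symm   : ∀ u v → adj u v ≡ adj v u
    irrefl : ∀ v → adj v v ≡ false

  Adj : Fin n → Fin n → Set
  Adj u v = T (adj u v)

  Adj-sym : ∀ {u v} → Adj u v → Adj v u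
  Adj-sym {u} {v} = subst T (symm u v)

  -- Each undirected edge is listed once, with its smaller endpoint first.
  edges : List (Fin n × Fin n)
  edges = filterᵇ (λ (u , v) → adj u v)
            (filterᵇ (λ (u , v) → does (u <? v)) (cartesianProduct (allFin n) (allFin n)))

  ∣E∣ : ℕ
  ∣E∣ = length edges

open Graph public using (Adj; Adj-sym; ∣E∣)

private
  cyc-irrefl : ∀ k .{{_ : NonZero k}} → 2 < k → ∀ (i : Fin k) → suc (toℕ i) % k ≢ toℕ i
  cyc-irrefl k 2<k i eq with m≤n⇒m<n∨m≡n (toℕ<n i)
  ... | inj₁ lt = 1+n≢n (trans (sym (m<n⇒m%n≡m lt)) eq)
  ... | inj₂ last = <-irrefl (trans (cong suc i≡0) last) (<-trans (s≤s z<s) 2<k)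
    where
    i≡0 : 0 ≡ toℕ i
    i≡0 = trans (sym (n%n≡0 k)) (trans (cong (_% k) (sym last)) eq)

cycle : (k : ℕ) → 2 < k → Graph k
cycle k 2<k = record
  { adj    = λ i j → next i j ∨ next j i
  ; symm   = λ i j → ∨-comm (next i j) (next j i)
  ; irrefl = λ i → cong₂ _∨_ (next-irrefl i) (next-irrefl i)
  }
  where
  instance
    k≢0 : NonZero k
    k≢0 = >-nonZero (<-trans z<s 2<k)

  next : Fin k → Fin k → Bool
  next i j = does (suc (toℕ i) % k ≟ toℕ j)

  next-irrefl : ∀ i → next i i ≡ false
  next-irrefl i = dec-false (suc (toℕ i) % k ≟ toℕ i) (cyc-irrefl k 2<k i)

-- A not necessarily induced copy of H in G.
_⊑_ : ∀ {h n} → Graph h → Graph n → Set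
_⊑_ {h} {n} H G = Σ (Fin h → Fin n) λ f →
  Injective _≡_ _≡_ f × (∀ u v → Adj H u v → Adj G (f u) (f v))

_-Free : ∀ {h n} → Graph h → Graph n → Set
(H -Free) G = ¬ (H ⊑ G)

_△_ : ∀ {n} → Graph n → Graph n → Graph n
G △ G′ = record
  { adj    = λ u v → adj G u v xor adj G′ u v
  ; symm   = λ u v → cong₂ _xor_ (symm G u v) (symm G′ u v)
  ; irrefl = λ v → cong₂ _xor_ (irrefl G v) (irrefl G′ v)
  }
  where open Graph

fromℕ : ℕ → ℚ
fromℕ m = + m ℚ./ 1

-- The number of edge additions and removals turning G into G′ is ∣E∣ (G △ G′).
Far : ∀ {n} → ℚ → (Graph n → Set) → Graph n → Set
Far {n} ε P G = ∀ (G′ : Graph n) → P G′ → ε ℚ.* fromℕ (∣E∣ G) ℚ.≤ fromℕ (∣E∣ (G △ G′))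

-- The elements of Fin n only name the nodes in the analysis and are never
-- visible to an algorithm, which refers to neighbours through the ports
-- numbered 0, …, degree v ∸ 1.  The numbering is arbitrary and need not be
-- consistent between nodes.
record Network (idBits n : ℕ) : Set where
  field
    graph    : Graph n
    ident    : Fin n → Vec Bool idBits
    ident-injective : Injective _≡_ _≡_ ident
    degree   : Fin n → ℕ
    port     : ∀ v → Fin (degree v) ↔ ∃ (Adj graph v)

-- The program run by every node; any global knowledge (such as n) is expressed
-- by letting the program depend on it.  A node starts from its degree, its
-- identifier and a private string of random bits, which it may use at any
-- later time.  Each round consists of sending one message through each port
-- and then updating the state from the messages received.
record Program (idBits bandwidth : ℕ) : Set₁ where
  Message : Set
  Message = Vec≤ Bool bandwidth

  field
    rounds     : ℕ
    randomBits : ℕ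
    State      : ℕ → Set
    init       : ∀ d → Vec Bool idBits → Vec Bool randomBits → State d
    send       : ∀ {d} → State d → Fin d → Message
    receive    : ∀ {d} → State d → (Fin d → Message) → State d
    accepts    : ∀ {d} → State d → Bool

allVecs : ∀ {A : Set} → List A → ∀ n → List (Vec A n)
allVecs xs zero    = [ Vec.[] ]
allVecs xs (suc n) = cartesianProductWith Vec._∷_ xs (allVecs xs n)

module Execution {idBits bandwidth n : ℕ} (A : Program idBits bandwidth) (N : Network idBits n) where
  open Program A
  open Network N

  Coins : Set
  Coins = Vec (Vec Bool randomBits) n

  allCoins : List Coins
  allCoins = allVecs (allVecs (true ∷ false ∷ []) randomBits) n

  stateAfter : ℕ → Coins → (v : Fin n) → State (degree v)
  stateAfter zero    ω v = init (degree v) (ident v) (lookup ω v)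
  stateAfter (suc t) ω v = receive (stateAfter t ω v) incoming
    where
    incoming : Fin (degree v) → Message
    incoming p = let (w , vw) = Inverse.to (port v) p in
      send (stateAfter t ω w) (Inverse.from (port w) (v , Adj-sym graph vw))

  nodeAccepts : Coins → Fin n → Bool
  nodeAccepts ω v = accepts (stateAfter rounds ω v)

  allAccept someRejects : Coins → Bool
  allAccept   ω = all (nodeAccepts ω) (allFin n)
  someRejects ω = any (not ∘ nodeAccepts ω) (allFin n)

  Pr : (Coins → Bool) → ℚ
  Pr event = ((+ length (filterᵇ event allCoins)) ℚ./ ((2 ^ randomBits) ^ n))
               {{m^n≢0 (2 ^ randomBits) n {{m^n≢0 2 randomBits}}}}

-- Identifiers have c · ⌈log₂ n⌉ bits, messages at most b · ⌈log₂ n⌉ bits, and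
-- the program may depend on ε and n.
record CongestAlgorithm (c b : ℕ) : Set₁ where
  field
    program : (ε : ℚ) (n : ℕ) → Program (c * ⌈log₂ n ⌉) (b * ⌈log₂ n ⌉)

open CongestAlgorithm public using (program)

-- An edgeless graph is vacuously at distance ≥ ε · 0 from every property,
-- including those it satisfies, so rejection is required only when there is an
-- edge.
TestsFreeness : ∀ {h c b} → Graph h → CongestAlgorithm c b → Set
TestsFreeness {c = c} H A =
  ∀ ε → 0ℚ ℚ.< ε → ε ℚ.≤ 1ℚ → ∀ n (N : Network (c * ⌈log₂ n ⌉) n) →
  let open Execution (program A ε n) N in
    ((H -Free) (Network.graph N) → + 2 ℚ./ 3 ℚ.≤ Pr allAccept)
  × (0 < ∣E∣ (Network.graph N) → Far ε (H -Free) (Network.graph N) → + 2 ℚ./ 3 ℚ.≤ Pr someRejects)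

OneSided : ∀ {h c b} → Graph h → CongestAlgorithm c b → Set
OneSided {c = c} H A =
  ∀ ε → 0ℚ ℚ.< ε → ε ℚ.≤ 1ℚ → ∀ n (N : Network (c * ⌈log₂ n ⌉) n) →
  let open Execution (program A ε n) N in
  (H -Free) (Network.graph N) → Pr allAccept ≡ 1ℚ

-- At most C / ε rounds.
RunsWithin : ∀ {c b} → ℕ → CongestAlgorithm c b → Set
RunsWithin C A =
  ∀ ε → 0ℚ ℚ.< ε → ε ℚ.≤ 1ℚ → ∀ n → fromℕ (Program.rounds (program A ε n)) ℚ.* ε ℚ.≤ fromℕ C

{-# OPTIONS --safe #-}
module Submission where

-- The algorithm works in Θ(1/ε) independent phases of k rounds.  In a phase
-- every node draws a colour and, for each port, a random rank; a node of colour
-- 0 sends (rank, identifier) through each port, a node of colour s forwards in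
-- round s + 1 the best-ranked token that reached it in round s, and a node of
-- colour 0 rejects if one of its own tokens comes back in round k.  The vertices
-- visited by a token have distinct colours, so a rejection exhibits a k-cycle.
--
-- Deleting every edge that lies on a k-cycle makes the graph C_k-free, so an
-- ε-far graph has at least ε∣E∣ such edges.  If the 2∣E∣ ranks have a unique
-- winner, belonging to an arc of a k-cycle whose vertices are coloured
-- consecutively from it, its token survives and the phase rejects.  A rank
-- "leads" if it starts with j zeros, where 2 ^ j ≈ 4∣E∣; by a union bound an arc
-- is the only leading one with probability Ω(1/∣E∣), so a phase succeeds with
-- probability Ω(ε).

open import Defs
open import Data.Bool.Base using (Bool; true; false; if_then_else_; not; _∨_; _∧_; _xor_; T)
open import Data.Bool.ListAction using (all; any)
import Data.Bool.Properties as Bool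
open import Data.Empty using (⊥)
open import Data.Fin.Base using (Fin; zero; suc; toℕ; fromℕ<; combine; inject≤; splitAt; _↑ˡ_; _↑ʳ_)
import Data.Fin.Properties as Fin
open import Data.Integer.Base as ℤ using (+_)
import Data.Integer.Properties as ℤ
open import Data.List.Base as List using (List; []; _∷_; length; map; filterᵇ; allFin; cartesianProduct; cartesianProductWith; _++_)
import Data.List.Membership.DecPropositional as DecMembership
open import Data.List.Membership.Propositional using (_∈_; find; lose)
open import Data.List.Membership.Propositional.Properties using (∈-allFin; ∈-cartesianProduct⁺; ∈-filter⁺; ∈-map⁻; ∈-tabulate⁺; ∈-tabulate⁻; ∈-++⁺ˡ; ∈-++⁺ʳ; ∈-++⁻)
import Data.List.Properties as List
open import Data.List.Relation.Unary.All as All using (All; []; _∷_)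
import Data.List.Relation.Unary.All.Properties as All
open import Data.List.Relation.Unary.AllPairs as AllPairs using (AllPairs; []; _∷_)
import Data.List.Relation.Unary.AllPairs.Properties as AllPairs
open import Data.List.Relation.Unary.Any as Any using (Any; here; there)
open import Data.List.Relation.Unary.Unique.Propositional using (Unique)
import Data.List.Relation.Unary.Unique.Propositional.Properties as Unique
open import Data.Nat.Base hiding (∣_-_∣)
open import Data.Nat.Coprimality using (Coprime)
open import Data.Nat.DivMod
open import Data.Nat.Induction using (<-wellFounded)
open import Data.Nat.Logarithm using (⌈log₂_⌉)
open import Data.Nat.Logarithm.Core using (⌈log2⌉)
open import Data.Nat.Properties
open import Data.Nat.Tactic.RingSolver using (solve-∀)
open import Data.Product.Base using (Σ; _×_; _,_; proj₁; proj₂; ∃)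
open import Data.Product.Properties using (≡-dec)
open import Data.Rational.Base as ℚ using (ℚ; mkℚ; 1ℚ; toℚᵘ)
import Data.Rational.Properties as ℚ
open import Data.Rational.Unnormalised.Base as ℚᵘ using (mkℚᵘ)
import Data.Rational.Unnormalised.Properties as ℚᵘ
open import Data.Sum.Base using (_⊎_; inj₁; inj₂)
open import Data.Unit.Base using (tt)
open import Data.Vec.Base as Vec using (Vec; lookup; updateAt; zipWith)
open import Data.Vec.Bounded.Base as Vec≤ using (Vec≤)
import Data.Vec.Properties as Vec
open import Function.Base using (_∘_; const; id)
open import Function.Bundles using (Inverse; Equivalence)
open import Function.Definitions using (Injective)
open import Induction.WellFounded using (Acc; acc)
open import Relation.Binary.Definitions using (DecidableEquality; tri<; tri≈; tri>)
open import Relation.Binary.PropositionalEquality hiding (J)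
open import Relation.Nullary.Decidable using (Dec; yes; no; does; dec-true; dec-false; map′; ¬?; _×-dec_; _→-dec_)
open import Relation.Nullary.Negation using (¬_; contradiction)

-- A message has room for exactly one token, while a node may hear one from each neighbour, so
-- tokens must be dropped; the ranks decide which. No node knows `∣E∣`, so the threshold `j` lives
-- in the analysis only: the program just compares numbers of leading zeros, and a token that alone
-- has at least `j` of them is never dropped in favour of another. Working with a threshold instead
-- of comparing whole ranks turns every event into a conjunction of prescribed bits, whose
-- probability is exactly a power of 1/2, and the union bound then involves pairs of arcs only.
-- Denominators are multiplied out, so that probabilities remain counts in ℕ until the very end.

private variable
  A A′ A″ : Set

-- Sums over lists and probabilities as counts

∑ : List A → (A → ℕ) → ℕ
∑ []       f = 0
∑ (x ∷ xs) f = f x + ∑ xs f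

∑-cong : ∀ (xs : List A) {f g} → (∀ x → f x ≡ g x) → ∑ xs f ≡ ∑ xs g
∑-cong []       eq = refl
∑-cong (x ∷ xs) eq = cong₂ _+_ (eq x) (∑-cong xs eq)

∑-mono : ∀ (xs : List A) {f g} → (∀ x → f x ≤ g x) → ∑ xs f ≤ ∑ xs g
∑-mono []       le = z≤n
∑-mono (x ∷ xs) le = +-mono-≤ (le x) (∑-mono xs le)

∑-+ : ∀ (xs : List A) f g → ∑ xs (λ x → f x + g x) ≡ ∑ xs f + ∑ xs g
∑-+ []       f g = refl
∑-+ (x ∷ xs) f g rewrite ∑-+ xs f g = shuffle (f x) (g x) (∑ xs f) (∑ xs g)
  where
  shuffle : ∀ a b c d → a + b + (c + d) ≡ a + c + (b + d)
  shuffle = solve-∀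

∑-*ˡ : ∀ (xs : List A) c f → ∑ xs (λ x → c * f x) ≡ c * ∑ xs f
∑-*ˡ []       c f = sym (*-zeroʳ c)
∑-*ˡ (x ∷ xs) c f rewrite ∑-*ˡ xs c f = sym (*-distribˡ-+ c (f x) (∑ xs f))

∑-const : ∀ (xs : List A) c → ∑ xs (λ _ → c) ≡ length xs * c
∑-const []       c = refl
∑-const (x ∷ xs) c = cong₂ _+_ {c} refl (∑-const xs c)

∑-swap : ∀ (xs : List A) (ys : List A′) (f : A → A′ → ℕ) →
         ∑ xs (λ x → ∑ ys (f x)) ≡ ∑ ys (λ y → ∑ xs (λ x → f x y))
∑-swap []       ys f = sym (trans (∑-const ys 0) (*-zeroʳ (length ys)))
∑-swap (x ∷ xs) ys f rewrite ∑-swap xs ys f = sym (∑-+ ys (f x) _)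

∑-++ : ∀ (xs ys : List A) f → ∑ (xs ++ ys) f ≡ ∑ xs f + ∑ ys f
∑-++ []       ys f = refl
∑-++ (x ∷ xs) ys f rewrite ∑-++ xs ys f = sym (+-assoc (f x) _ _)

∑-map : ∀ (g : A → A′) xs f → ∑ (map g xs) f ≡ ∑ xs (f ∘ g)
∑-map g []       f = refl
∑-map g (x ∷ xs) f = cong₂ _+_ {f (g x)} refl (∑-map g xs f)

∑-cartesianProductWith : ∀ (g : A → A′ → A″) xs ys f →
  ∑ (cartesianProductWith g xs ys) f ≡ ∑ xs (λ x → ∑ ys (λ y → f (g x y)))
∑-cartesianProductWith g []       ys f = refl
∑-cartesianProductWith g (x ∷ xs) ys f
  rewrite ∑-++ (map (g x) ys) (cartesianProductWith g xs ys) f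
        | ∑-map (g x) ys f
        | ∑-cartesianProductWith g xs ys f = refl

⟦_⟧ : Bool → ℕ
⟦ b ⟧ = if b then 1 else 0

∑-filterᵇ : ∀ (p : A → Bool) xs → ∑ xs (λ x → ⟦ p x ⟧) ≡ length (filterᵇ p xs)
∑-filterᵇ p []       = refl
∑-filterᵇ p (x ∷ xs) with p x
... | true  = cong suc (∑-filterᵇ p xs)
... | false = ∑-filterᵇ p xs

length-cartesianProductWith : ∀ (g : A → A′ → A″) xs ys →
  length (cartesianProductWith g xs ys) ≡ length xs * length ys
length-cartesianProductWith g []       ys = refl
length-cartesianProductWith g (x ∷ xs) ys
  rewrite List.length-++ (map (g x) ys) {cartesianProductWith g xs ys}
        | List.length-map (g x) ys
        | length-cartesianProductWith g xs ys = refl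

length-allVecs : ∀ (xs : List A) n → length (allVecs xs n) ≡ length xs ^ n
length-allVecs xs zero    = refl
length-allVecs xs (suc n)
  rewrite length-cartesianProductWith Vec._∷_ xs (allVecs xs n) | length-allVecs xs n = refl

-- Random bits and the chance of prescribing distinct ones

bits : ∀ B → List (Vec Bool B)
bits = allVecs (true ∷ false ∷ [])

assignments : ∀ n B → List (Vec (Vec Bool B) n)
assignments n B = allVecs (bits B) n

length-assignments : ∀ n B → length (assignments n B) ≡ (2 ^ B) ^ n
length-assignments n B =
  trans (length-allVecs (bits B) n) (cong (_^ n) (length-allVecs (true ∷ false ∷ []) B))

-- Drawing an entry and then overwriting it by g or by h, each with
-- probability 1/2, does not change its distribution.
Resamples : List A → (g h : A → A) → Set
Resamples {A} xs g h = ∀ (f : A → ℕ) → 2 * ∑ xs f ≡ ∑ xs (f ∘ g) + ∑ xs (f ∘ h)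

resamples-updateAt : ∀ {xs : List A} {g h} → Resamples xs g h → ∀ {n} (v : Fin n) →
  Resamples (allVecs xs n) (λ α → updateAt α v g) (λ α → updateAt α v h)
resamples-updateAt {xs = xs} {g} {h} res {suc n} zero f
  rewrite ∑-cartesianProductWith Vec._∷_ xs (allVecs xs n) f
        | ∑-cartesianProductWith Vec._∷_ xs (allVecs xs n) (λ α → f (updateAt α zero g))
        | ∑-cartesianProductWith Vec._∷_ xs (allVecs xs n) (λ α → f (updateAt α zero h))
  = res (λ x → ∑ (allVecs xs n) (λ α → f (x Vec.∷ α)))
resamples-updateAt {xs = xs} {g} {h} res {suc n} (suc v) f
  rewrite ∑-cartesianProductWith Vec._∷_ xs (allVecs xs n) f
        | ∑-cartesianProductWith Vec._∷_ xs (allVecs xs n) (λ α → f (updateAt α (suc v) g))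
        | ∑-cartesianProductWith Vec._∷_ xs (allVecs xs n) (λ α → f (updateAt α (suc v) h))
  = trans (sym (∑-*ˡ xs 2 _))
   (trans (∑-cong xs (λ x → resamples-updateAt res v (λ α → f (x Vec.∷ α))))
          (∑-+ xs _ _))

Site : ℕ → ℕ → Set
Site n B = Fin n × Fin B

bitAt : ∀ {n B} → Vec (Vec Bool B) n → Site n B → Bool
bitAt α (v , b) = lookup (lookup α v) b

setBit : ∀ {n B} → Site n B → Bool → Vec (Vec Bool B) n → Vec (Vec Bool B) n
setBit (v , b) x α = updateAt α v (λ w → updateAt w b (const x))

bitAt-setBit : ∀ {n B} (s : Site n B) x α → bitAt (setBit s x α) s ≡ x
bitAt-setBit (v , b) x α
  rewrite Vec.lookup∘updateAt v {λ w → updateAt w b (const x)} α =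
  Vec.lookup∘updateAt b (lookup α v)

bitAt-setBit′ : ∀ {n B} (s s′ : Site n B) x α → s ≢ s′ → bitAt (setBit s x α) s′ ≡ bitAt α s′
bitAt-setBit′ (v , b) (v′ , b′) x α s≢s′ with v′ Fin.≟ v
... | no v′≢v rewrite Vec.lookup∘updateAt′ v′ v {λ w → updateAt w b (const x)} v′≢v α = refl
... | yes refl
  rewrite Vec.lookup∘updateAt v {λ w → updateAt w b (const x)} α =
  Vec.lookup∘updateAt′ b′ b (λ { refl → s≢s′ refl }) (lookup α v)

Constraint : ℕ → ℕ → Set
Constraint n B = Site n B × Bool

sites : ∀ {n B} → List (Constraint n B) → List (Site n B)
sites = map proj₁

Satisfies : ∀ {n B} → List (Constraint n B) → Vec (Vec Bool B) n → Set
Satisfies cs α = All (λ (s , x) → bitAt α s ≡ x) cs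

satisfies? : ∀ {n B} (cs : List (Constraint n B)) α → Dec (Satisfies cs α)
satisfies? cs α = All.all? (λ (s , x) → bitAt α s Bool.≟ x) cs

[_satisfies_] : ∀ {n B} → Vec (Vec Bool B) n → List (Constraint n B) → ℕ
[ α satisfies cs ] = ⟦ does (satisfies? cs α) ⟧

satisfied : ∀ {n B} (cs : List (Constraint n B)) α → Satisfies cs α → [ α satisfies cs ] ≡ 1
satisfied cs α p = cong ⟦_⟧ (dec-true (satisfies? cs α) p)

unsatisfied : ∀ {n B} (cs : List (Constraint n B)) α → ¬ Satisfies cs α → [ α satisfies cs ] ≡ 0
unsatisfied cs α p = cong ⟦_⟧ (dec-false (satisfies? cs α) p)

satisfies-setBit : ∀ {n B} (s : Site n B) x cs α → All (s ≢_) (sites cs) →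
  [ setBit s x α satisfies cs ] ≡ [ α satisfies cs ]
satisfies-setBit s x cs α fresh with satisfies? cs α
... | yes p = satisfied cs (setBit s x α) (All.zipWith (λ { (eq , s≢) → trans (bitAt-setBit′ s _ x α s≢) eq })
                          (p , All.map⁻ fresh))
... | no ¬p = unsatisfied cs (setBit s x α) λ p → ¬p
  (All.zipWith (λ { (eq , s≢) → trans (sym (bitAt-setBit′ s _ x α s≢)) eq }) (p , All.map⁻ fresh))

satisfies-set-head : ∀ {n B} (s : Site n B) x cs α → All (s ≢_) (sites cs) →
  [ setBit s true α satisfies (s , x) ∷ cs ] + [ setBit s false α satisfies (s , x) ∷ cs ]
    ≡ [ α satisfies cs ]
satisfies-set-head s true cs α fresh
  rewrite bitAt-setBit s true α | bitAt-setBit s false α | satisfies-setBit s true cs α fresh =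
  +-identityʳ _
satisfies-set-head s false cs α fresh
  rewrite bitAt-setBit s true α | bitAt-setBit s false α = satisfies-setBit s false cs α fresh

-- Each constraint halves the count: resampling its bit by a fair coin preserves the distribution,
-- exactly one outcome of the coin meets the constraint, and distinctness of the sites keeps the
-- other constraints unaffected.
∑-satisfies : ∀ n B (cs : List (Constraint n B)) → Unique (sites cs) →
  2 ^ length cs * ∑ (assignments n B) [_satisfies cs ] ≡ (2 ^ B) ^ n
∑-satisfies n B [] [] = begin
  1 * ∑ (assignments n B) (λ _ → 1) ≡⟨ *-identityˡ _ ⟩
  ∑ (assignments n B) (λ _ → 1)     ≡⟨ ∑-const (assignments n B) 1 ⟩
  length (assignments n B) * 1      ≡⟨ *-identityʳ _ ⟩
  length (assignments n B)          ≡⟨ length-assignments n B ⟩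
  (2 ^ B) ^ n                       ∎
  where open ≡-Reasoning
∑-satisfies n B ((s , x) ∷ cs) (fresh ∷ unique) = begin
  2 * 2 ^ length cs * ∑ Ω [_satisfies (s , x) ∷ cs ]
    ≡⟨ shuffle (2 ^ length cs) _ ⟩
  2 ^ length cs * (2 * ∑ Ω [_satisfies (s , x) ∷ cs ])
    ≡⟨ cong (2 ^ length cs *_) (resample [_satisfies (s , x) ∷ cs ]) ⟩
  2 ^ length cs * (∑ Ω _ + ∑ Ω _)
    ≡⟨ cong (2 ^ length cs *_) (sym (∑-+ Ω _ _)) ⟩
  2 ^ length cs * ∑ Ω _
    ≡⟨ cong (2 ^ length cs *_) (∑-cong Ω (λ α → satisfies-set-head s x cs α fresh)) ⟩
  2 ^ length cs * ∑ Ω [_satisfies cs ]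
    ≡⟨ ∑-satisfies n B cs unique ⟩
  (2 ^ B) ^ n ∎
  where
  open ≡-Reasoning
  Ω = assignments n B
  shuffle : ∀ a b → 2 * a * b ≡ a * (2 * b)
  shuffle = solve-∀
  coin : Resamples (true ∷ false ∷ []) (const true) (const false)
  coin f = lemma (f true) (f false)
    where
    lemma : ∀ a b → 2 * (a + (b + 0)) ≡ (a + (a + 0)) + (b + (b + 0))
    lemma = solve-∀
  resample : Resamples Ω (setBit s true) (setBit s false)
  resample = resamples-updateAt (resamples-updateAt coin (proj₂ s)) (proj₁ s)

-- Independence of the phases

∑-bits-++ : ∀ B B′ (f : Vec Bool (B + B′) → ℕ) →
  ∑ (bits (B + B′)) f ≡ ∑ (bits B) (λ x → ∑ (bits B′) (λ y → f (x Vec.++ y)))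
∑-bits-++ zero    B′ f = sym (+-identityʳ _)
∑-bits-++ (suc B) B′ f
  rewrite ∑-cartesianProductWith Vec._∷_ (true ∷ false ∷ []) (bits (B + B′)) f
        | ∑-cartesianProductWith Vec._∷_ (true ∷ false ∷ []) (bits B)
            (λ x → ∑ (bits B′) (λ y → f (x Vec.++ y))) =
  ∑-cong (true ∷ false ∷ []) (λ b → ∑-bits-++ B B′ (λ z → f (b Vec.∷ z)))

∑-assignments-++ : ∀ n B B′ (f : Vec (Vec Bool (B + B′)) n → ℕ) →
  ∑ (assignments n (B + B′)) f ≡
  ∑ (assignments n B) (λ α → ∑ (assignments n B′) (λ β → f (zipWith Vec._++_ α β)))
∑-assignments-++ zero    B B′ f = sym (+-identityʳ _)
∑-assignments-++ (suc n) B B′ f = begin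
  ∑ (assignments (suc n) (B + B′)) f
    ≡⟨ ∑-cartesianProductWith Vec._∷_ (bits (B + B′)) (assignments n (B + B′)) f ⟩
  ∑ (bits (B + B′)) (λ z → ∑ (assignments n (B + B′)) (λ γ → f (z Vec.∷ γ)))
    ≡⟨ ∑-bits-++ B B′ _ ⟩
  ∑ (bits B) (λ x → ∑ (bits B′) (λ y → ∑ (assignments n (B + B′)) (λ γ → f ((x Vec.++ y) Vec.∷ γ))))
    ≡⟨ ∑-cong (bits B) (λ x → ∑-cong (bits B′) (λ y → ∑-assignments-++ n B B′ _)) ⟩
  ∑ (bits B) (λ x → ∑ (bits B′) (λ y → ∑ (assignments n B) (λ α → ∑ (assignments n B′) (λ β →
    f ((x Vec.++ y) Vec.∷ zipWith Vec._++_ α β)))))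
    -- Coins are stored node by node, whereas phases cut across all nodes: the later bits of the
    -- first node must move past the earlier bits of the others.
    ≡⟨ ∑-cong (bits B) (λ x → ∑-swap (bits B′) (assignments n B) _) ⟩
  ∑ (bits B) (λ x → ∑ (assignments n B) (λ α → ∑ (bits B′) (λ y → ∑ (assignments n B′) (λ β →
    f ((x Vec.++ y) Vec.∷ zipWith Vec._++_ α β)))))
    ≡⟨ ∑-cong (bits B) (λ x → ∑-cong (assignments n B) (λ α →
         sym (∑-cartesianProductWith Vec._∷_ (bits B′) (assignments n B′) _))) ⟩
  ∑ (bits B) (λ x → ∑ (assignments n B) (λ α → ∑ (assignments (suc n) B′) (λ β →
    f (zipWith Vec._++_ (x Vec.∷ α) β))))
    ≡⟨ sym (∑-cartesianProductWith Vec._∷_ (bits B) (assignments n B) _) ⟩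
  ∑ (assignments (suc n) B) (λ α → ∑ (assignments (suc n) B′) (λ β → f (zipWith Vec._++_ α β))) ∎
  where open ≡-Reasoning

-- Junk (all false) for t ≥ T.
block : ∀ T B → ℕ → Vec Bool (T * B) → Vec Bool B
block zero    B t       x = Vec.replicate B false
block (suc T) B zero    x = Vec.take B x
block (suc T) B (suc t) x = block T B t (Vec.drop B x)

blocks : ∀ T B → ℕ → ∀ {n} → Vec (Vec Bool (T * B)) n → Vec (Vec Bool B) n
blocks T B t = Vec.map (block T B t)

take-++ : ∀ {m n} (xs : Vec A m) (ys : Vec A n) → Vec.take m (xs Vec.++ ys) ≡ xs
take-++ {m = m} xs ys = Vec.++-injectiveˡ _ xs (Vec.take++drop≡id m (xs Vec.++ ys))

drop-++ : ∀ {m n} (xs : Vec A m) (ys : Vec A n) → Vec.drop m (xs Vec.++ ys) ≡ ys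
drop-++ {m = m} xs ys = Vec.++-injectiveʳ _ xs (Vec.take++drop≡id m (xs Vec.++ ys))

map-take-zipWith-++ : ∀ {m B B′} (α : Vec (Vec A B) m) (β : Vec (Vec A B′) m) →
  Vec.map (Vec.take B) (zipWith Vec._++_ α β) ≡ α
map-take-zipWith-++ Vec.[]      Vec.[]      = refl
map-take-zipWith-++ (x Vec.∷ α) (y Vec.∷ β) = cong₂ Vec._∷_ (take-++ x y) (map-take-zipWith-++ α β)

map-drop-zipWith-++ : ∀ {m B B′} (α : Vec (Vec A B) m) (β : Vec (Vec A B′) m) →
  Vec.map (Vec.drop B) (zipWith Vec._++_ α β) ≡ β
map-drop-zipWith-++ Vec.[]      Vec.[]      = refl
map-drop-zipWith-++ (x Vec.∷ α) (y Vec.∷ β) = cong₂ Vec._∷_ (drop-++ x y) (map-drop-zipWith-++ α β)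

-- For a 0/1-valued `g` this is the indicator that `g` holds in all `T` phases. Peeling off one
-- phase at a time makes the product rule an induction on `T`.
∏-blocks : ∀ {n} T B → (Vec (Vec Bool B) n → ℕ) → Vec (Vec Bool (T * B)) n → ℕ
∏-blocks zero    B g ω = 1
∏-blocks (suc T) B g ω = g (Vec.map (Vec.take B) ω) * ∏-blocks T B g (Vec.map (Vec.drop B) ω)

∏-blocks≡1 : ∀ {n} T B (g : Vec (Vec Bool B) n → ℕ) ω →
  (∀ t → t < T → g (blocks T B t ω) ≡ 1) → ∏-blocks T B g ω ≡ 1
∏-blocks≡1 zero    B g ω one = refl
∏-blocks≡1 (suc T) B g ω one
  rewrite one 0 z<s
        | ∏-blocks≡1 T B g (Vec.map (Vec.drop B) ω)
            (λ t t<T → trans (cong g (sym (Vec.map-∘ (block T B t) (Vec.drop B) ω))) (one (suc t) (s<s t<T)))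
  = refl

∑-∏-blocks : ∀ n T B (g : Vec (Vec Bool B) n → ℕ) →
  ∑ (assignments n (T * B)) (∏-blocks T B g) ≡ ∑ (assignments n B) g ^ T
∑-∏-blocks n zero B g = begin
  ∑ (assignments n 0) (λ _ → 1) ≡⟨ ∑-const (assignments n 0) 1 ⟩
  length (assignments n 0) * 1  ≡⟨ *-identityʳ _ ⟩
  length (assignments n 0)      ≡⟨ length-assignments n 0 ⟩
  1 ^ n                         ≡⟨ ^-zeroˡ n ⟩
  1                             ∎
  where open ≡-Reasoning
∑-∏-blocks n (suc T) B g = begin
  ∑ (assignments n (B + T * B)) (∏-blocks (suc T) B g)
    ≡⟨ ∑-assignments-++ n B (T * B) _ ⟩
  ∑ (assignments n B) (λ α → ∑ (assignments n (T * B)) (λ β → ∏-blocks (suc T) B g (zipWith Vec._++_ α β)))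
    ≡⟨ ∑-cong (assignments n B) (λ α → ∑-cong (assignments n (T * B)) (λ β → split α β)) ⟩
  ∑ (assignments n B) (λ α → ∑ (assignments n (T * B)) (λ β → g α * ∏-blocks T B g β))
    ≡⟨ ∑-cong (assignments n B) (λ α → trans (∑-*ˡ (assignments n (T * B)) (g α) _) (*-comm (g α) (∑ (assignments n (T * B)) (∏-blocks T B g)))) ⟩
  ∑ (assignments n B) (λ α → ∑ (assignments n (T * B)) (∏-blocks T B g) * g α)
    ≡⟨ trans (∑-*ˡ (assignments n B) (∑ (assignments n (T * B)) (∏-blocks T B g)) g) (*-comm _ (∑ (assignments n B) g)) ⟩
  ∑ (assignments n B) g * ∑ (assignments n (T * B)) (∏-blocks T B g)
    ≡⟨ cong (∑ (assignments n B) g *_) (∑-∏-blocks n T B g) ⟩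
  ∑ (assignments n B) g * ∑ (assignments n B) g ^ T ∎
  where
  open ≡-Reasoning
  split : ∀ α β → ∏-blocks (suc T) B g (zipWith Vec._++_ α β) ≡ g α * ∏-blocks T B g β
  split α β = cong₂ (λ x y → g x * ∏-blocks T B g y) (map-take-zipWith-++ α β) (map-drop-zipWith-++ α β)

-- (1 - S/D)^T ≤ 1 / (1 + T S/D), with D = F + S.
failure-power : ∀ F S T → F ^ T * (F + S + T * S) ≤ (F + S) ^ T * (F + S)
failure-power F S zero    = ≤-reflexive (cong (1 *_) (+-identityʳ (F + S)))
failure-power F S (suc T) = begin
  F * F ^ T * (F + S + suc T * S)                    ≤⟨ m≤m+n _ (F ^ T * (S * S * (1 + T))) ⟩
  F * F ^ T * (F + S + suc T * S) + F ^ T * (S * S * (1 + T)) ≡⟨ expand (F ^ T) F S T ⟩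
  (F + S) * (F ^ T * (F + S + T * S))                ≤⟨ *-monoʳ-≤ (F + S) (failure-power F S T) ⟩
  (F + S) * ((F + S) ^ T * (F + S))                  ≡⟨ *-assoc (F + S) _ _ ⟨
  (F + S) ^ suc T * (F + S)                          ∎
  where
  open ≤-Reasoning
  expand : ∀ P F S T → F * P * (F + S + (S + T * S)) + P * (S * S * (1 + T)) ≡ (F + S) * (P * (F + S + T * S))
  expand = solve-∀

-- With D = F + S, the assumption T S ≥ 2 D turns the bound 1 / (1 + T S / D) on the failure
-- probability into 1/3.
amplification : ∀ F S T .{{_ : NonZero (F + S)}} → 2 * (F + S) ≤ T * S → 3 * F ^ T ≤ (F + S) ^ T
amplification F S T enough = *-cancelʳ-≤ (3 * F ^ T) ((F + S) ^ T) (F + S) (begin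
  3 * F ^ T * (F + S)             ≡⟨ shuffle (F ^ T) (F + S) ⟩
  F ^ T * (F + S + 2 * (F + S))   ≤⟨ *-monoʳ-≤ (F ^ T) (+-monoʳ-≤ (F + S) enough) ⟩
  F ^ T * (F + S + T * S)         ≤⟨ failure-power F S T ⟩
  (F + S) ^ T * (F + S)           ∎)
  where
  open ≤-Reasoning
  shuffle : ∀ P D → 3 * P * D ≡ P * (D + 2 * D)
  shuffle = solve-∀

-- The distributed tester

leadingFalses : ∀ {l} → Vec Bool l → ℕ
leadingFalses (false Vec.∷ xs) = suc (leadingFalses xs)
leadingFalses _                = 0

Leads : ∀ {l} → ℕ → Vec Bool l → Set
Leads j r = ∀ q → toℕ q < j → lookup r q ≡ false

leads⇒leadingFalses : ∀ {j l m} → j ≤ l → (r : Vec Bool l) (i : Vec Bool m) →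
  Leads j r → j ≤ leadingFalses (r Vec.++ i)
leads⇒leadingFalses z≤n       r                i leads = z≤n
leads⇒leadingFalses (s≤s j≤l) (true  Vec.∷ r) i leads with () ← leads zero z<s
leads⇒leadingFalses (s≤s j≤l) (false Vec.∷ r) i leads =
  s≤s (leads⇒leadingFalses j≤l r i (λ q q<j → leads (suc q) (s<s q<j)))

-- Priority is read off the whole message, so a run of zeros may continue from the rank into the
-- identifier; in that case every bit of the rank is `false` anyway.
leadingFalses⇒leads : ∀ {l m} j (r : Vec Bool l) (i : Vec Bool m) →
  j ≤ leadingFalses (r Vec.++ i) → Leads j r
leadingFalses⇒leads (suc j) (false Vec.∷ r) i (s≤s le) zero    _         = refl
leadingFalses⇒leads (suc j) (false Vec.∷ r) i (s≤s le) (suc q) (s≤s q<j) =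
  leadingFalses⇒leads j r i le q q<j

module CycleTester (k′ n a m W : ℕ) .(fits : a + m ≤ W) where

  k = suc k′

  -- `k` bits for the colour and one rank of `a` bits for each of `n` possible ports; degrees are at
  -- most `n`, so one length of string serves all nodes.
  phaseBits : ℕ
  phaseBits = k + n * a

  Msg : Set
  Msg = Vec≤ Bool W

  _≟ᴹ_ : DecidableEquality Msg
  (xs Vec≤., _) ≟ᴹ (ys Vec≤., _) with Vec.length xs ≟ Vec.length ys
  ... | no  ≢    = no λ { refl → ≢ refl }
  ... | yes refl with Vec.≡-dec Bool._≟_ xs ys
  ...   | no  ≢    = no λ { refl → ≢ refl }
  ...   | yes refl = yes refl

  token : Vec Bool a → Vec Bool m → Msg
  token r i = (r Vec.++ i) Vec≤., fits

  silence : Msg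
  silence = Vec≤.[]

  priority : Msg → ℕ
  priority (xs Vec≤., _) = leadingFalses xs

  _⊕_ : Msg → Msg → Msg
  x ⊕ y with priority y ≤? priority x
  ... | yes _ = x
  ... | no  _ = y

  select : List Msg → Msg
  select = List.foldr _⊕_ silence

  colourBit : Fin k → Fin phaseBits
  colourBit b = b ↑ˡ (n * a)

  rankBit : Fin n → Fin a → Fin phaseBits
  rankBit p q = k ↑ʳ combine p q

  -- Colour s is encoded by the s-th unit vector; other vectors are no colour.
  HasColour : ℕ → Vec Bool phaseBits → Set
  HasColour s x = ∀ b → lookup x (colourBit b) ≡ does (toℕ b ≟ s)

  abstract
    hasColour? : ∀ s x → Dec (HasColour s x)
    hasColour? s x = Fin.all? λ b → lookup x (colourBit b) Bool.≟ does (toℕ b ≟ s)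

  -- The value for p ≥ n is junk, as every degree is at most n.
  rank : Vec Bool phaseBits → ℕ → Vec Bool a
  rank x p with p <? n
  ... | yes p<n = Vec.tabulate λ q → lookup x (rankBit (fromℕ< p<n) q)
  ... | no  _   = Vec.replicate a true

  emit : Vec Bool phaseBits → Vec Bool m → ℕ → Msg → ℕ → Msg
  emit x i zero    held p = if does (hasColour? 0 x) then token (rank x p) i else silence
  emit x i (suc _) held p = held

  absorb : Vec Bool phaseBits → ℕ → List Msg → Msg
  absorb x s heard = if does (hasColour? (suc s) x) then select heard else silence

  ownTokens : Vec Bool phaseBits → Vec Bool m → ℕ → List Msg
  ownTokens x i d = List.tabulate {n = d} λ p → token (rank x (toℕ p)) i

  -- If ranks and identifiers have no bits, a token coincides with `silence`; excluding `silence`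
  -- keeps such a node from mistaking an empty message for its own token.
  Returns : List Msg → List Msg → Set
  Returns heard own = Any (λ μ → μ ≢ silence × μ ∈ own) heard

  abstract
    returns? : ∀ heard own → Dec (Returns heard own)
    returns? heard own = Any.any? (λ μ → ¬? (μ ≟ᴹ silence) ×-dec DecMembership._∈?_ _≟ᴹ_ μ own) heard

  record State (T : ℕ) : Set where
    constructor state
    field
      ident      : Vec Bool m
      coins      : Vec Bool (T * phaseBits)
      phase step : ℕ
      held       : Msg
      rejected   : Bool

  phaseCoins : ∀ {T} → State T → Vec Bool phaseBits
  phaseCoins {T} st = block T phaseBits (State.phase st) (State.coins st)

  advance : ∀ {T} → ℕ → State T → List Msg → State T
  advance d st@(state i ω t s μ r) heard =
    if does (s ≟ k′)
    -- The colour of the node is not tested here: a token with its identifier can only have been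
    -- emitted by the node itself, which therefore has colour 0.
    then state i ω (suc t) 0 silence (r ∨ does (returns? heard (ownTokens (phaseCoins st) i d)))
    else state i ω t (suc s) (absorb (phaseCoins st) s heard) r

  tester : ℕ → Program m W
  tester T = record
    { rounds     = T * k
    ; randomBits = T * phaseBits
    ; State      = λ _ → State T
    ; init       = λ _ i ω → state i ω 0 0 silence false
    ; send       = λ st p → emit (phaseCoins st) (State.ident st) (State.step st) (State.held st) (toℕ p)
    ; receive    = λ {d} st incoming → advance d st (List.tabulate incoming)
    ; accepts    = not ∘ State.rejected
    }

  token-injectiveʳ : ∀ r r′ {i i′} → token r i ≡ token r′ i′ → i ≡ i′
  token-injectiveʳ r r′ eq = Vec.++-injectiveʳ r r′ (vec-injective eq)
    where
    vec-injective : ∀ {l} {xs ys : Vec Bool l} .{p q : l ≤ W} → (xs Vec≤., p) ≡ (ys Vec≤., q) → xs ≡ ys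
    vec-injective refl = refl

  select-∈ : ∀ μs → select μs ≢ silence → select μs ∈ μs
  select-∈ []       loud = contradiction refl loud
  select-∈ (μ ∷ μs) loud with priority (select μs) ≤? priority μ
  ... | yes _ = here refl
  ... | no  _ = there (select-∈ μs loud)

  -- Whatever `_⊕_` prefers to `μ` has priority at least `j` too, and so is `μ` again by uniqueness.
  -- It cannot be `silence`, whose priority 0 never beats anything.
  select-maximal : ∀ {j μ} → j ≤ priority μ → ∀ μs →
    (∀ {ν} → ν ∈ μs → j ≤ priority ν → ν ≡ μ) → μ ∈ μs → select μs ≡ μ
  select-maximal high (ν ∷ νs) only (here refl) with priority (select νs) ≤? priority ν
  ... | yes _  = refl
  ... | no  ≰ν = only (there (select-∈ νs loud)) higher
    where
    higher = ≤-trans high (<⇒≤ (≰⇒> ≰ν))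
    loud : select νs ≢ silence
    loud quiet = ≰ν (subst (λ μ → priority μ ≤ priority ν) (sym quiet) z≤n)
  select-maximal {j} {μ} high (ν ∷ νs) only (there μ∈νs)
    rewrite select-maximal high νs (only ∘ there) μ∈νs with priority μ ≤? priority ν
  ... | yes μ≤ν = only (here refl) (≤-trans high μ≤ν)
  ... | no  _   = refl

  -- Bit number `s`, which exists because `s < k`, is `true` under colour `s`, and under `s′` only
  -- if the two agree.
  colour-unique : ∀ s s′ x → s < k → HasColour s x → HasColour s′ x → s ≡ s′
  colour-unique s s′ x s<k col col′ = subst (_≡ s′) (Fin.toℕ-fromℕ< s<k)
    (decide (toℕ b ≟ s′) (trans (sym (col′ b)) (trans (col b) (dec-true (toℕ b ≟ s) (Fin.toℕ-fromℕ< s<k)))))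
    where
    b = fromℕ< s<k
    decide : ∀ {P : Set} (P? : Dec P) → does P? ≡ true → P
    decide (yes p) _ = p

  -- Soundness and completeness of a single phase

  module OnNetwork (N : Network m n) where
    open Network N

    portTo : ∀ v w → Adj graph v w → Fin (degree v)
    portTo v w vw = Inverse.from (port v) (w , vw)

    module Phase (α : Vec (Vec Bool phaseBits) n) where

      -- The messages of one phase as functions of the coins of that phase alone, so that its
      -- outcomes can be counted apart from the rest of the execution.
      held    : ℕ → Fin n → Msg
      out     : ℕ → (v : Fin n) → Fin (degree v) → Msg
      arrival : ℕ → (v : Fin n) → ∃ (Adj graph v) → Msg
      heard   : ℕ → Fin n → List Msg

      held zero    v = silence
      held (suc s) v = absorb (lookup α v) s (heard s v)

      out s v p = emit (lookup α v) (ident v) s (held s v) (toℕ p)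

      arrival s v (w , vw) = out s w (portTo w v (Adj-sym graph vw))

      heard s v = List.tabulate λ p → arrival s v (Inverse.to (port v) p)

      Detects : Fin n → Set
      Detects v = Returns (heard k′ v) (ownTokens (lookup α v) (ident v) (degree v))

      detects? : ∀ v → Dec (Detects v)
      detects? v = returns? (heard k′ v) (ownTokens (lookup α v) (ident v) (degree v))

      data Trail (u : Fin n) : ℕ → Fin n → Set where
        start : HasColour 0 (lookup α u) → Trail u 0 u
        step  : ∀ {s w v} → Trail u s w → Adj graph w v → HasColour (suc s) (lookup α v) → Trail u (suc s) v

      -- Tokens are forwarded unaltered, and only by nodes that pass the colour test, so any audible
      -- message can be traced back to its emitter.
      out-trail : ∀ s w p → out s w p ≢ silence →
        ∃ λ u → ∃ λ r → Trail u s w × out s w p ≡ token r (ident u)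
      held-trail : ∀ s w → held s w ≢ silence →
        ∃ λ u → ∃ λ r → Trail u s w × held s w ≡ token r (ident u)
      out-trail zero    w p loud with hasColour? 0 (lookup α w)
      ... | yes red = w , rank (lookup α w) (toℕ p) , start red , refl
      ... | no  _   = contradiction refl loud
      out-trail (suc s) w p loud = held-trail (suc s) w loud
      held-trail zero    w loud = contradiction refl loud
      held-trail (suc s) w loud with hasColour? (suc s) (lookup α w)
      ... | no  _   = contradiction refl loud
      ... | yes col with ∈-tabulate⁻ (select-∈ (heard s w) loud)
      ...   | p , eq with out-trail s _ _ (λ quiet → loud (trans eq quiet))
      ...     | u , r , trail , eq′ =
        u , r , step trail (Adj-sym graph (proj₂ (Inverse.to (port w) p))) col , trans eq eq′

      -- Past the end of the trail the value stays at the last vertex.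
      at : ∀ {u s w} → Trail u s w → ℕ → Fin n
      at {u} (start _)              i = u
      at     (step {s} {v = v} tr _ _) i with i ≤? s
      ... | yes _ = at tr i
      ... | no  _ = v

      at-start : ∀ {u s w} (tr : Trail u s w) → at tr 0 ≡ u
      at-start (start _)    = refl
      at-start (step tr _ _) = at-start tr

      at-end : ∀ {u s w} (tr : Trail u s w) → at tr s ≡ w
      at-end (start _) = refl
      at-end (step {s} tr _ _) with suc s ≤? s
      ... | yes 1+s≤s = contradiction refl (<⇒≢ 1+s≤s)
      ... | no  _   = refl

      at-colour : ∀ {u s w} (tr : Trail u s w) i → i ≤ s → HasColour i (lookup α (at tr i))
      at-colour (start red) zero _ = red
      at-colour (step {s} tr _ col) i i≤1+s with i ≤? s
      ... | yes i≤s = at-colour tr i i≤s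
      ... | no  i≰s rewrite ≤-antisym i≤1+s (≰⇒> i≰s) = col

      at-adj : ∀ {u s w} (tr : Trail u s w) i → i < s → Adj graph (at tr i) (at tr (suc i))
      at-adj (step {s} tr e _) i (s≤s i≤s) with i ≤? s | suc i ≤? s
      ... | no i≰s | _       = contradiction i≤s i≰s
      ... | yes _  | yes i<s = at-adj tr i i<s
      ... | yes _  | no  i≮s rewrite ≤-antisym i≤s (≮⇒≥ i≮s) | at-end tr = e

      -- Position `i` has colour `i`, so equal vertices have equal positions: distinctness is
      -- guaranteed without any message recording its route.
      closed-trail⇒cycle : ∀ (2<k : 2 < k) {u w} → Trail u k′ w → Adj graph w u → cycle k 2<k ⊑ graph
      closed-trail⇒cycle 2<k {u} {w} tr e = f , injective , homomorphic
        where
        f : Fin k → Fin n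
        f i = at tr (toℕ i)
        injective : Injective _≡_ _≡_ f
        injective {i} {j} fi≡fj = Fin.toℕ-injective (colour-unique (toℕ i) (toℕ j) (lookup α (f i)) (Fin.toℕ<n i)
          (at-colour tr (toℕ i) (Fin.toℕ≤pred[n] i))
          (subst (HasColour (toℕ j) ∘ lookup α) (sym fi≡fj) (at-colour tr (toℕ j) (Fin.toℕ≤pred[n] j))))
        next : ∀ i j → suc (toℕ i) % k ≡ toℕ j → Adj graph (f i) (f j)
        next i j eq with toℕ i <? k′
        ... | yes i<k′ =
          subst (Adj graph (f i) ∘ at tr) (trans (sym (m<n⇒m%n≡m (s<s i<k′))) eq) (at-adj tr (toℕ i) i<k′)
        ... | no  i≮k′ with i≡k′ ← ≤-antisym (Fin.toℕ≤pred[n] i) (≮⇒≥ i≮k′) =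
          subst₂ (Adj graph)
            (sym (trans (cong (at tr) i≡k′) (at-end tr)))
            (sym (trans (cong (at tr) (trans (sym eq) (trans (cong (λ x → suc x % k) i≡k′) (n%n≡0 k)))) (at-start tr)))
            e
        homomorphic : ∀ i j → Adj (cycle k 2<k) i j → Adj graph (f i) (f j)
        homomorphic i j ij with Equivalence.to Bool.T-∨ ij
        ... | inj₁ i→j = next i j (≡ᵇ⇒≡ _ _ i→j)
        ... | inj₂ j→i = Adj-sym graph (next j i (≡ᵇ⇒≡ _ _ j→i))

      -- Identifiers are unique, so the trail of a returned token starts at `v` itself, and the edge
      -- over which the token was heard closes it.
      detects⇒cycle : ∀ (2<k : 2 < k) {v} → Detects v → cycle k 2<k ⊑ graph
      detects⇒cycle 2<k {v} found with find found
      ... | μ , μ∈heard , loud , μ∈own with ∈-tabulate⁻ μ∈heard | ∈-tabulate⁻ μ∈own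
      ...   | p , eq | q , own with out-trail k′ _ _ (λ quiet → loud (trans eq quiet))
      ...     | u , r , tr , eq′
        with refl ← ident-injective (token-injectiveʳ _ _ (trans (sym (trans eq eq′)) own)) =
        closed-trail⇒cycle 2<k tr (Adj-sym graph (proj₂ (Inverse.to (port v) p)))

      -- `only` ranges over all arcs of the network, not just those of the cycle, so the winning
      -- token cannot be outbid by traffic from elsewhere. `0<j` ensures that `silence` does not
      -- reach the threshold.
      module Winner (j : ℕ) (0<j : 0 < j) (j≤a : j ≤ a)
        (c : ℕ → Fin n) (c-adj : ∀ (s : ℕ) → Adj graph (c s) (c (suc s))) (c-closed : c k ≡ c 0)
        (c-colour : ∀ (s : ℕ) → s ≤ k′ → HasColour s (lookup α (c s)))
        (leads : Leads j (rank (lookup α (c 0)) (toℕ (portTo (c 0) (c 1) (c-adj 0)))))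
        (only : ∀ (v : Fin n) (p : Fin (degree v)) → Leads j (rank (lookup α v) (toℕ p)) →
                (v , p) ≡ (c 0 , portTo (c 0) (c 1) (c-adj 0)))
        where

        winner : Msg
        winner = token (rank (lookup α (c 0)) (toℕ (portTo (c 0) (c 1) (c-adj 0)))) (ident (c 0))

        winner-priority : j ≤ priority winner
        winner-priority = leads⇒leadingFalses j≤a (rank (lookup α (c 0)) (toℕ (portTo (c 0) (c 1) (c-adj 0)))) (ident (c 0)) leads

        priority-silence : ¬ j ≤ priority silence
        priority-silence j≤0 = <-irrefl refl (≤-trans 0<j j≤0)

        out-unique : ∀ s v p → j ≤ priority (out s v p) → out s v p ≡ winner
        held-unique : ∀ s v → j ≤ priority (held s v) → held s v ≡ winner
        heard-unique : ∀ s v {μ} → μ ∈ heard s v → j ≤ priority μ → μ ≡ winner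
        out-unique zero    v p high with hasColour? 0 (lookup α v)
        ... | no  _ = contradiction high priority-silence
        ... | yes _ = cong (λ (v , p) → token (rank (lookup α v) (toℕ p)) (ident v))
                           (only v p (leadingFalses⇒leads j (rank (lookup α v) (toℕ p)) (ident v) high))
        out-unique (suc s) v p high = held-unique (suc s) v high
        held-unique zero    v high = contradiction high priority-silence
        held-unique (suc s) v high with hasColour? (suc s) (lookup α v)
        ... | no  _ = contradiction high priority-silence
        ... | yes _ = heard-unique s v
          (select-∈ (heard s v) λ quiet → priority-silence (subst ((j ≤_) ∘ priority) quiet high)) high
        heard-unique s v μ∈ high with ∈-tabulate⁻ μ∈
        ... | p , refl = out-unique s _ _ high

        ∈-heard : ∀ s v w (vw : Adj graph v w) → arrival s v (w , vw) ≡ winner → winner ∈ heard s v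
        ∈-heard s v w vw eq = subst (_∈ heard s v)
          (trans (cong (arrival s v) (Inverse.strictlyInverseˡ (port v) (w , vw))) eq)
          (∈-tabulate⁺ (portTo v w vw))

        arrival-winner : ∀ s → s ≤ k′ → arrival s (c (suc s)) (c s , Adj-sym graph (c-adj s)) ≡ winner
        arrival-winner zero    _
          rewrite dec-true (hasColour? 0 (lookup α (c 0))) (c-colour 0 z≤n) =
          -- The two ports differ only in the proof of adjacency, which here has been reversed
          -- twice.
          cong (λ e → token (rank (lookup α (c 0)) (toℕ (portTo (c 0) (c 1) e))) (ident (c 0)))
               (Bool.T-irrelevant _ _)
        arrival-winner (suc s) s<k′
          rewrite dec-true (hasColour? (suc s) (lookup α (c (suc s)))) (c-colour (suc s) s<k′) =
          select-maximal winner-priority (heard s (c (suc s))) (heard-unique s (c (suc s)))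
            (∈-heard s (c (suc s)) (c s) _ (arrival-winner s (<⇒≤ s<k′)))

        detected : Detects (c 0)
        detected = lose
          (subst (λ v → winner ∈ heard k′ v) c-closed (∈-heard k′ (c k) (c k′) _ (arrival-winner k′ ≤-refl)))
          ( (λ quiet → priority-silence (subst ((j ≤_) ∘ priority) quiet winner-priority))
          , ∈-tabulate⁺ (portTo (c 0) (c 1) (c-adj 0)))

    open Phase public

    -- The execution as a sequence of phases

    module Run (T : ℕ) where
      open Execution (tester T) N

      phaseOf : ℕ → Coins → Vec (Vec Bool phaseBits) n
      phaseOf t ω = blocks T phaseBits t ω

      rejectedBefore : ℕ → Coins → Fin n → Bool
      rejectedBefore zero    ω v = false
      rejectedBefore (suc t) ω v = rejectedBefore t ω v ∨ does (detects? (phaseOf t ω) v)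

      expected : ℕ → ℕ → Coins → Fin n → State T
      expected t s ω v =
        state (ident v) (lookup ω v) t s (held (phaseOf t ω) s v) (rejectedBefore t ω v)

      phaseCoins-lookup : ∀ t ω v → block T phaseBits t (lookup ω v) ≡ lookup (phaseOf t ω) v
      phaseCoins-lookup t ω v = sym (Vec.lookup-map v (block T phaseBits t) ω)

      incoming≡heard : ∀ t s ω r → (∀ v → stateAfter r ω v ≡ expected t s ω v) → ∀ v →
        stateAfter (suc r) ω v ≡ advance (degree v) (expected t s ω v) (heard (phaseOf t ω) s v)
      incoming≡heard t s ω r eq v = cong₂ (advance (degree v)) (eq v) (List.tabulate-cong λ p →
        let (w , vw) = Inverse.to (port v) p
            q = portTo w v (Adj-sym graph vw)
        in trans (cong (λ st → emit (phaseCoins st) (State.ident st) (State.step st) (State.held st) (toℕ q)) (eq w))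
                 (cong (λ x → emit x (ident w) s (held (phaseOf t ω) s w) (toℕ q)) (phaseCoins-lookup t ω w)))

      -- Time `s + t * k` is step `s` of phase `t`. A new phase begins one round after step `k′` of
      -- the previous one, since `suc t * k` unfolds to `suc (k′ + t * k)`.
      stateAfter≡expected : ∀ ω t s → s ≤ k′ → ∀ v → stateAfter (s + t * k) ω v ≡ expected t s ω v
      stateAfter≡expected ω zero    zero    _    v = refl
      stateAfter≡expected ω (suc t) zero    _    v =
        trans (incoming≡heard t k′ ω (k′ + t * k) (stateAfter≡expected ω t k′ ≤-refl) v) end
        where
        end : advance (degree v) (expected t k′ ω v) (heard (phaseOf t ω) k′ v) ≡ expected (suc t) 0 ω v
        end rewrite dec-true (k′ ≟ k′) refl | phaseCoins-lookup t ω v = refl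
      stateAfter≡expected ω t       (suc s) s<k′ v =
        trans (incoming≡heard t s ω (s + t * k) (stateAfter≡expected ω t s (<⇒≤ s<k′)) v) next
        where
        next : advance (degree v) (expected t s ω v) (heard (phaseOf t ω) s v) ≡ expected t (suc s) ω v
        next rewrite dec-false (s ≟ k′) (<⇒≢ s<k′) | phaseCoins-lookup t ω v = refl

      nodeAccepts≡ : ∀ ω v → nodeAccepts ω v ≡ not (rejectedBefore T ω v)
      nodeAccepts≡ ω v = cong (not ∘ State.rejected) (stateAfter≡expected ω T 0 z≤n v)

      rejectedBefore-false : ∀ ω v t → (∀ t′ → t′ < t → ¬ Detects (phaseOf t′ ω) v) →
        rejectedBefore t ω v ≡ false
      rejectedBefore-false ω v zero    none = refl
      rejectedBefore-false ω v (suc t) none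
        rewrite rejectedBefore-false ω v t (λ t′ t′<t → none t′ (m<n⇒m<1+n t′<t)) =
        dec-false (detects? (phaseOf t ω) v) (none t ≤-refl)

      rejectedBefore-true : ∀ ω v t t′ → t′ < t → Detects (phaseOf t′ ω) v → rejectedBefore t ω v ≡ true
      rejectedBefore-true ω v (suc t) t′ (s≤s t′≤t) found with t′ ≟ t
      ... | yes refl rewrite dec-true (detects? (phaseOf t ω) v) found = Bool.∨-zeroʳ _
      ... | no  t′≢t rewrite rejectedBefore-true ω v t t′ (≤∧≢⇒< t′≤t t′≢t) found = refl

-- Edges on k-cycles

module Edges {n : ℕ} (G : Graph n) where

  private
    joined ordered : Fin n × Fin n → Bool
    joined  (u , v) = Graph.adj G u v
    ordered (u , v) = does (u Fin.<? v)
    pairs = cartesianProduct (allFin n) (allFin n)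

  edges-sound : All (λ (u , v) → Adj G u v × toℕ u < toℕ v) (Graph.edges G)
  edges-sound = All.zip
    ( All.all-filter (Bool.T? ∘ joined) (filterᵇ ordered pairs)
    , All.filter⁺ (Bool.T? ∘ joined) (All.map (λ {(u , v)} → <ᵇ⇒< (toℕ u) (toℕ v)) (All.all-filter (Bool.T? ∘ ordered) pairs)))

  edges-complete : ∀ {u v} → Adj G u v → toℕ u < toℕ v → (u , v) ∈ Graph.edges G
  edges-complete {u} {v} uv u<v = ∈-filter⁺ (Bool.T? ∘ joined)
    (∈-filter⁺ (Bool.T? ∘ ordered) (∈-cartesianProduct⁺ (∈-allFin u) (∈-allFin v)) (<⇒<ᵇ u<v)) uv

  edges-unique : Unique (Graph.edges G)
  edges-unique = Unique.filter⁺ (Bool.T? ∘ joined) (Unique.filter⁺ (Bool.T? ∘ ordered)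
    (Unique.cartesianProduct⁺ (Unique.allFin⁺ n) (Unique.allFin⁺ n)))

  ∣E∣≤n*n : ∣E∣ G ≤ n * n
  ∣E∣≤n*n = begin
    ∣E∣ G                          ≤⟨ List.length-filter (Bool.T? ∘ joined) (filterᵇ ordered pairs) ⟩
    length (filterᵇ ordered pairs) ≤⟨ List.length-filter (Bool.T? ∘ ordered) pairs ⟩
    length pairs                   ≡⟨ length-cartesianProductWith _,_ (allFin n) (allFin n) ⟩
    length (allFin n) * length (allFin n) ≡⟨ cong (λ x → x * x) (List.length-tabulate {n = n} id) ⟩
    n * n                          ∎
    where open ≤-Reasoning

-- Indexing by ℕ lets a token be followed by plain successors; the single wrap-around is the
-- equation `closed`.
record Cycle {n : ℕ} (G : Graph n) (k : ℕ) : Set where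
  field
    vertex   : ℕ → Fin n
    adjacent : ∀ s → Adj G (vertex s) (vertex (suc s))
    closed   : vertex k ≡ vertex 0
    distinct : ∀ {i j} → i < k → j < k → vertex i ≡ vertex j → i ≡ j

open Cycle
open Edges

∃-vec? : ∀ {n} k {P : Vec (Fin n) k → Set} → (∀ xs → Dec (P xs)) → Dec (∃ P)
∃-vec? zero    P? = map′ (Vec.[] ,_) (λ { (Vec.[] , p) → p }) (P? Vec.[])
∃-vec? (suc k) P? = map′ (λ { (x , xs , p) → x Vec.∷ xs , p }) (λ { (x Vec.∷ xs , p) → x , xs , p })
  (Fin.any? λ x → ∃-vec? k λ xs → P? (x Vec.∷ xs))

cycle-edge⁺ : ∀ k .{{k≢0 : NonZero k}} (2<k : 2 < k) i j → suc (toℕ i) % k ≡ toℕ j → Adj (cycle k 2<k) i j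
cycle-edge⁺ (suc _) 2<k i j eq = Equivalence.from Bool.T-∨ (inj₁ (≡⇒≡ᵇ _ (toℕ j) eq))

module CycleEdges {n : ℕ} (G : Graph n) (k : ℕ) .{{_ : NonZero k}} (2<k : 2 < k) where

  toℕ-mod : ∀ s → toℕ (s mod k) ≡ s % k
  toℕ-mod s = Fin.toℕ-fromℕ< (m%n<n s k)

  mod-edge : ∀ s → Adj (cycle k 2<k) (s mod k) (suc s mod k)
  mod-edge s = cycle-edge⁺ k 2<k (s mod k) (suc s mod k) (begin
    suc (toℕ (s mod k)) % k ≡⟨ cong (λ x → suc x % k) (toℕ-mod s) ⟩
    -- Distributing `%` over the sum requires 1 to be a remainder as well, which it is because 1 <
    -- k.
    suc (s % k) % k         ≡⟨ cong (λ x → (x + s % k) % k) (sym (m<n⇒m%n≡m (<-trans (n<1+n 1) 2<k))) ⟩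
    (1 % k + s % k) % k     ≡⟨ sym (%-distribˡ-+ 1 s k) ⟩
    suc s % k               ≡⟨ sym (toℕ-mod (suc s)) ⟩
    toℕ (suc s mod k)       ∎)
    where open ≡-Reasoning

  IsCopy : Vec (Fin n) k → Set
  IsCopy xs = (∀ i j → lookup xs i ≡ lookup xs j → i ≡ j)
            × (∀ i j → Adj (cycle k 2<k) i j → Adj G (lookup xs i) (lookup xs j))

  CycleThrough : Fin n → Fin n → Set
  CycleThrough u v = ∃ λ xs → IsCopy xs × lookup xs (0 mod k) ≡ u × lookup xs (1 mod k) ≡ v

  abstract
    -- Exhaustive search over all k-tuples of nodes, because `withoutCycles` needs a Boolean
    -- adjacency. It belongs to the analysis; no node performs it.
    cycleThrough? : ∀ u v → Dec (CycleThrough u v)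
    cycleThrough? u v = ∃-vec? k λ xs →
      ((Fin.all? λ i → Fin.all? λ j → (lookup xs i Fin.≟ lookup xs j) →-dec (i Fin.≟ j)) ×-dec
       (Fin.all? λ i → Fin.all? λ j → Bool.T? _ →-dec Bool.T? _)) ×-dec
      (lookup xs (0 mod k) Fin.≟ u) ×-dec (lookup xs (1 mod k) Fin.≟ v)

  copy⇒cycle : ∀ xs → IsCopy xs → Cycle G k
  copy⇒cycle xs (inj , hom) = record
    { vertex   = λ s → lookup xs (s mod k)
    ; adjacent = λ s → hom (s mod k) (suc s mod k) (mod-edge s)
    ; closed   = cong (lookup xs) (Fin.toℕ-injective (trans (toℕ-mod k) (trans (n%n≡0 k)
                   (sym (trans (toℕ-mod 0) (m<n⇒m%n≡m (<-trans z<s 2<k)))))))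
    ; distinct = λ {i} {j} i<k j<k eq → begin
        i              ≡⟨ sym (m<n⇒m%n≡m i<k) ⟩
        i % k          ≡⟨ sym (toℕ-mod i) ⟩
        toℕ (i mod k)  ≡⟨ cong toℕ (inj (i mod k) (j mod k) eq) ⟩
        toℕ (j mod k)  ≡⟨ toℕ-mod j ⟩
        j % k          ≡⟨ m<n⇒m%n≡m j<k ⟩
        j              ∎
    }
    where open ≡-Reasoning

  onCycle : Fin n → Fin n → Bool
  onCycle u v = does (cycleThrough? u v) ∨ does (cycleThrough? v u)

  onCycle-true : ∀ {u v} → T (onCycle u v) → CycleThrough u v ⊎ CycleThrough v u
  onCycle-true {u} {v} on with cycleThrough? u v | cycleThrough? v u
  ... | yes uv | _      = inj₁ uv
  ... | no  _  | yes vu = inj₂ vu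

  onCycle-false : ∀ {u v} → T (not (onCycle u v)) → ¬ CycleThrough u v
  onCycle-false {u} {v} off uv rewrite dec-true (cycleThrough? u v) uv = off

  withoutCycles : Graph n
  withoutCycles = record
    { adj    = λ u v → adj u v ∧ not (onCycle u v)
    ; symm   = λ u v → cong₂ (λ x y → x ∧ not y) (symm u v)
                         (Bool.∨-comm (does (cycleThrough? u v)) (does (cycleThrough? v u)))
    ; irrefl = λ v → cong (_∧ not (onCycle v v)) (irrefl v)
    }
    where open Graph G

  T-∧ : ∀ x {y} → T (x ∧ y) → T x × T y
  T-∧ true y = tt , y

  -- A surviving copy is also a copy in `G`, so its own first edge is an edge on a k-cycle and has
  -- been removed.
  withoutCycles-free : (cycle k 2<k -Free) withoutCycles
  withoutCycles-free (f , inj , hom) = onCycle-false (proj₂ (T-∧ (Graph.adj G (f (0 mod k)) (f (1 mod k))) (hom (0 mod k) (1 mod k) (mod-edge 0))))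
    ( Vec.tabulate f
    , ( (λ i j eq → inj (trans (sym (Vec.lookup∘tabulate f i)) (trans eq (Vec.lookup∘tabulate f j))))
      , (λ i j ij → subst₂ (Adj G) (sym (Vec.lookup∘tabulate f i)) (sym (Vec.lookup∘tabulate f j))
                      (proj₁ (T-∧ (Graph.adj G (f i) (f j)) (hom i j ij)))))
    , Vec.lookup∘tabulate f (0 mod k) , Vec.lookup∘tabulate f (1 mod k))

  Joins : Cycle G k → Fin n × Fin n → Set
  Joins c (u , v) = (vertex c 0 ≡ u × vertex c 1 ≡ v) ⊎ (vertex c 0 ≡ v × vertex c 1 ≡ u)

  CyclicEdge : Fin n × Fin n → Set
  CyclicEdge (u , v) = toℕ u < toℕ v × ∃ λ c → Joins c (u , v)

  removed-cyclic : ∀ u v → toℕ u < toℕ v → Adj (G △ withoutCycles) u v → CyclicEdge (u , v)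
  removed-cyclic u v u<v removed with onCycle-true {u} {v} (meets (Graph.adj G u v) (onCycle u v) removed)
    where
    meets : ∀ x y → T (x xor (x ∧ not y)) → T y
    meets true true _ = tt
  ... | inj₁ (xs , copy , eq₀ , eq₁) = u<v , copy⇒cycle xs copy , inj₁ (eq₀ , eq₁)
  ... | inj₂ (xs , copy , eq₀ , eq₁) = u<v , copy⇒cycle xs copy , inj₂ (eq₀ , eq₁)

  removedEdges-cyclic : All CyclicEdge (Graph.edges (G △ withoutCycles))
  removedEdges-cyclic = All.map (λ { {u , v} (removed , u<v) → removed-cyclic u v u<v removed })
    (edges-sound (G △ withoutCycles))

  -- Each removed edge carries one chosen cycle starting along it, in one of the two directions;
  -- these cycles index the events whose probabilities are summed.
  cyclicEdges : List (∃ CyclicEdge)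
  cyclicEdges = All.toList removedEdges-cyclic

  cyclicCycle : ∃ CyclicEdge → Cycle G k
  cyclicCycle (_ , _ , c , _) = c

  map-proj₁-toList : ∀ {A : Set} {P : A → Set} {xs} (ps : All P xs) → List.map proj₁ (All.toList ps) ≡ xs
  map-proj₁-toList []       = refl
  map-proj₁-toList (p ∷ ps) = cong (_ ∷_) (map-proj₁-toList ps)

  length-cyclicEdges : length cyclicEdges ≡ ∣E∣ (G △ withoutCycles)
  length-cyclicEdges = trans (sym (List.length-map proj₁ cyclicEdges)) (cong length (map-proj₁-toList removedEdges-cyclic))

  SameStart : ∃ CyclicEdge → ∃ CyclicEdge → Set
  SameStart e e′ = vertex (cyclicCycle e) 0 ≡ vertex (cyclicCycle e′) 0
                 × vertex (cyclicCycle e) 1 ≡ vertex (cyclicCycle e′) 1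

  sameStart⇒≡ : ∀ e e′ → SameStart e e′ → proj₁ e ≡ proj₁ e′
  sameStart⇒≡ ((u , v) , u<v , c , joins) ((u′ , v′) , u′<v′ , c′ , joins′) (eq₀ , eq₁)
    with joins | joins′
  ... | inj₁ (refl , refl) | inj₁ (refl , refl) = cong₂ _,_ eq₀ eq₁
  ... | inj₂ (refl , refl) | inj₂ (refl , refl) = cong₂ _,_ eq₁ eq₀
  ... | inj₁ (refl , refl) | inj₂ (refl , refl) =
    contradiction (subst₂ (λ x y → toℕ x < toℕ y) eq₀ eq₁ u<v) (<-asym u′<v′)
  ... | inj₂ (refl , refl) | inj₁ (refl , refl) =
    contradiction (subst₂ (λ x y → toℕ x < toℕ y) eq₁ eq₀ u<v) (<-asym u′<v′)

  -- Edges list their smaller endpoint first, so chosen cycles that start along the same arc belong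
  -- to the same edge. Hence two of the events occurring together entail two different leading arcs.
  cyclicEdges-distinct : AllPairs (λ e e′ → ¬ SameStart e e′) cyclicEdges
  cyclicEdges-distinct = AllPairs.map (λ {e} {e′} e≢e′ same → e≢e′ (sameStart⇒≡ e e′ same))
    (AllPairs.map⁻ (subst Unique (sym (map-proj₁-toList removedEdges-cyclic)) (edges-unique (G △ withoutCycles))))

-- The success probability of a phase

∈⇒≤∑ : ∀ {x : A} {xs} f → x ∈ xs → f x ≤ ∑ xs f
∈⇒≤∑ {xs = x ∷ xs} f (here refl) = m≤m+n (f x) _
∈⇒≤∑ {xs = y ∷ xs} f (there x∈)  = ≤-trans (∈⇒≤∑ f x∈) (m≤n+m _ (f y))

∑-mono-All : ∀ {xs : List A} {f g} → All (λ x → f x ≤ g x) xs → ∑ xs f ≤ ∑ xs g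
∑-mono-All []         = z≤n
∑-mono-All (le ∷ les) = +-mono-≤ le (∑-mono-All les)

-- At most one of the events f is not outweighed by its own penalty g, and that
-- one is paid for by h.
∑-pairwise : ∀ {R : A → A → Set} {xs} (f g : A → ℕ) h → AllPairs R xs →
  (∀ x → f x ≤ h + g x) → (∀ {x y} → R x y → 0 < f x → f y ≤ g y) →
  ∑ xs f ≤ h + ∑ xs g
∑-pairwise f g h [] one rest = z≤n
∑-pairwise {xs = x ∷ xs} f g h (rx ∷ rxs) one rest with 0 <? f x
... | no  fx≯0 rewrite n≤0⇒n≡0 (≮⇒≥ fx≯0) =
  ≤-trans (∑-pairwise f g h rxs one rest) (+-monoʳ-≤ h (m≤n+m _ (g x)))
... | yes fx>0 = ≤-trans (+-mono-≤ (one x) (∑-mono-All (All.map (λ r → rest r fx>0) rx)))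
                         (≤-reflexive (+-assoc h (g x) _))

length-reduce : ∀ {P : A → Set} (f : ∀ {x} → P x → A′) {xs} (ps : All P xs) →
  length (All.reduce f ps) ≡ length xs
length-reduce f []       = refl
length-reduce f (p ∷ ps) = cong suc (length-reduce f ps)

∈-reduce : ∀ {P : A → Set} (f : ∀ {x} → P x → A′) {x xs} (ps : All P xs) → x ∈ xs →
  ∃ λ (p : P x) → f p ∈ All.reduce f ps
∈-reduce f (p ∷ ps) (here refl) = p , here refl
∈-reduce f (p ∷ ps) (there x∈)  with ∈-reduce f ps x∈
... | q , q∈ = q , there q∈

module Counting (k′ n a m W : ℕ) .(fits : a + m ≤ W) (N : Network m n) where

  open CycleTester k′ n a m W fits
  open OnNetwork N
  open Network N

  Arc : Set
  Arc = Σ (Fin n) (Fin ∘ degree)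

  _≟ᴬ_ : DecidableEquality Arc
  _≟ᴬ_ = ≡-dec Fin._≟_ Fin._≟_

  forward backward : ∀ {e : Fin n × Fin n} → Adj graph (proj₁ e) (proj₂ e) × toℕ (proj₁ e) < toℕ (proj₂ e) → Arc
  forward  {u , v} (uv , _) = u , portTo u v uv
  backward {u , v} (uv , _) = v , portTo v u (Adj-sym graph uv)

  -- Both directions of every edge, built from the edge list so that its length is exactly twice
  -- `∣E∣`; the union bound runs over it.
  arcs : List Arc
  arcs = All.reduce forward (edges-sound graph) ++ All.reduce backward (edges-sound graph)

  length-arcs : length arcs ≡ ∣E∣ graph + ∣E∣ graph
  length-arcs = trans (List.length-++ (All.reduce forward (edges-sound graph)))
    (cong₂ _+_ (length-reduce forward (edges-sound graph)) (length-reduce backward (edges-sound graph)))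

  portTo-irrelevant : ∀ v w (e e′ : Adj graph v w) → portTo v w e ≡ portTo v w e′
  portTo-irrelevant v w e e′ = cong (portTo v w) (Bool.T-irrelevant e e′)

  portTo∈arcs : ∀ v w (vw : Adj graph v w) → (v , portTo v w vw) ∈ arcs
  portTo∈arcs v w vw with Fin.<-cmp v w
  ... | tri< v<w _ _ with ∈-reduce forward (edges-sound graph) (edges-complete graph vw v<w)
  ...   | _ , e∈ =
    subst (λ p → (v , p) ∈ arcs) (portTo-irrelevant v w _ _) (∈-++⁺ˡ e∈)
  portTo∈arcs v w vw | tri> _ _ w<v with ∈-reduce backward (edges-sound graph) (edges-complete graph (Adj-sym graph vw) w<v)
  ...   | _ , e∈ =
    subst (λ p → (v , p) ∈ arcs) (portTo-irrelevant v w _ _) (∈-++⁺ʳ (All.reduce forward (edges-sound graph)) e∈)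
  portTo∈arcs v .v vv | tri≈ _ refl _ = contradiction (subst T (Graph.irrefl graph v) vv) λ ()

  ∈-arcs : ∀ e → e ∈ arcs
  ∈-arcs (v , p) = subst (λ p → (v , p) ∈ arcs) (Inverse.strictlyInverseʳ (port v) p) (portTo∈arcs v _ _)

  degree≤n : ∀ v → degree v ≤ n
  degree≤n v = Fin.injective⇒≤ {f = neighbour} injective
    where
    neighbour : Fin (degree v) → Fin n
    neighbour p = proj₁ (Inverse.to (port v) p)
    ≡-neighbour : ∀ {x y : ∃ (Adj graph v)} → proj₁ x ≡ proj₁ y → x ≡ y
    ≡-neighbour {w , e} {.w , e′} refl = cong (w ,_) (Bool.T-irrelevant e e′)
    injective : ∀ {p q} → neighbour p ≡ neighbour q → p ≡ q
    injective {p} {q} eq = trans (sym (Inverse.strictlyInverseʳ (port v) p))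
      (trans (cong (Inverse.from (port v)) (≡-neighbour eq)) (Inverse.strictlyInverseʳ (port v) q))

  slot : (e : Arc) → Fin n
  slot (v , p) = fromℕ< (<-≤-trans (Fin.toℕ<n p) (degree≤n v))

  slot-injective : ∀ {v p q} → slot (v , p) ≡ slot (v , q) → p ≡ q
  slot-injective {p = p} {q} eq = Fin.toℕ-injective (Fin.fromℕ<-injective (toℕ p) (toℕ q) _ _ eq)

  lookup-rank : ∀ x v (p : Fin (degree v)) q → lookup (rank x (toℕ p)) q ≡ lookup x (rankBit (slot (v , p)) q)
  lookup-rank x v p q with toℕ p <? n
  ... | yes _   = Vec.lookup∘tabulate _ q
  ... | no  p≮n = contradiction (<-≤-trans (Fin.toℕ<n p) (degree≤n v)) p≮n

  -- Leading and colouring as prescribed bits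

  module _ {j : ℕ} (j≤a : j ≤ a) where

    leadConstraint : Arc → Fin j → Constraint n phaseBits
    leadConstraint e@(v , _) q = (v , rankBit (slot e) (inject≤ q j≤a)) , false

    leadConstraints : Arc → List (Constraint n phaseBits)
    leadConstraints e = List.map (leadConstraint e) (allFin j)

    satisfies⇒leads : ∀ α {v p} → Satisfies (leadConstraints (v , p)) α → Leads j (rank (lookup α v) (toℕ p))
    satisfies⇒leads α {v} {p} sat q q<j = trans (lookup-rank (lookup α v) v p q)
      (subst (λ q → lookup (lookup α v) (rankBit (slot (v , p)) q) ≡ false)
        (Fin.toℕ-injective (trans (Fin.toℕ-inject≤ _ j≤a) (Fin.toℕ-fromℕ< q<j)))
        (All.lookup (All.map⁻ sat) (∈-allFin (fromℕ< q<j))))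

    leads⇒satisfies : ∀ α {v p} → Leads j (rank (lookup α v) (toℕ p)) → Satisfies (leadConstraints (v , p)) α
    leads⇒satisfies α {v} {p} leads = All.map⁺ (All.tabulate λ {q} _ →
      trans (sym (lookup-rank (lookup α v) v p (inject≤ q j≤a)))
            (leads (inject≤ q j≤a) (subst (_< j) (sym (Fin.toℕ-inject≤ q j≤a)) (Fin.toℕ<n q))))

    module _ (2<k : 2 < k) where

      open CycleEdges graph k 2<k

      colourConstraint : Cycle graph k → Fin k × Fin k → Constraint n phaseBits
      colourConstraint c (s , b) = (vertex c (toℕ s) , colourBit b) , does (toℕ b ≟ toℕ s)

      -- All k colour bits of all k vertices are prescribed, whence the factor 2 ^ (k * k) in
      -- `odds`.
      colourConstraints : Cycle graph k → List (Constraint n phaseBits)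
      colourConstraints c = List.map (colourConstraint c) (cartesianProduct (allFin k) (allFin k))

      satisfies⇒colour : ∀ α c → Satisfies (colourConstraints c) α →
        ∀ s → s ≤ k′ → HasColour s (lookup α (vertex c s))
      satisfies⇒colour α c sat s s≤k′ b =
        subst (λ s → lookup (lookup α (vertex c s)) (colourBit b) ≡ does (toℕ b ≟ s)) (Fin.toℕ-fromℕ< (s≤s s≤k′))
          (All.lookup (All.map⁻ sat) (∈-cartesianProduct⁺ (∈-allFin (fromℕ< (s≤s s≤k′))) (∈-allFin b)))

      firstArc : Cycle graph k → Arc
      firstArc c = vertex c 0 , portTo (vertex c 0) (vertex c 1) (adjacent c 0)

      -- The event that the first arc leads and the cycle is coloured consecutively from it.
      -- `double` adds that a further arc leads; the extra `j` bits make it rarer by a factor 2 ^ j.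
      single : Cycle graph k → List (Constraint n phaseBits)
      single c = leadConstraints (firstArc c) ++ colourConstraints c

      double : Cycle graph k → Arc → List (Constraint n phaseBits)
      double c e = leadConstraints e ++ single c

      sites-lead : ∀ e → sites (leadConstraints e) ≡ List.map (proj₁ ∘ leadConstraint e) (allFin j)
      sites-lead e = sym (List.map-∘ (allFin j))

      lead-unique : ∀ e → Unique (sites (leadConstraints e))
      lead-unique e@(v , p) = subst Unique (sym (sites-lead e)) (Unique.map⁺ injective (Unique.allFin⁺ j))
        where
        injective : ∀ {q q′} → proj₁ (leadConstraint e q) ≡ proj₁ (leadConstraint e q′) → q ≡ q′
        injective {q} {q′} eq = Fin.inject≤-injective j≤a j≤a q q′
          (Fin.combine-injectiveʳ (slot e) _ (slot e) _ (Fin.↑ʳ-injective k _ _ (cong proj₂ eq)))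

      lead-disjoint : ∀ {e e′ q q′} → proj₁ (leadConstraint e q) ≡ proj₁ (leadConstraint e′ q′) → e ≡ e′
      lead-disjoint {v , p} {v′ , p′} eq with refl ← cong proj₁ eq =
        cong (v ,_) (slot-injective (Fin.combine-injectiveˡ (slot (v , p)) _ (slot (v , p′)) _
          (Fin.↑ʳ-injective k _ _ (cong proj₂ eq))))

      colour-unique-sites : ∀ c → Unique (sites (colourConstraints c))
      colour-unique-sites c = subst Unique (List.map-∘ (cartesianProduct (allFin k) (allFin k)))
        (Unique.map⁺ injective (Unique.cartesianProduct⁺ (Unique.allFin⁺ k) (Unique.allFin⁺ k)))
        where
        injective : ∀ {x y} → proj₁ (colourConstraint c x) ≡ proj₁ (colourConstraint c y) → x ≡ y
        injective {s , b} {s′ , b′} eq = cong₂ _,_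
          (Fin.toℕ-injective (distinct c (Fin.toℕ<n s) (Fin.toℕ<n s′) (cong proj₁ eq)))
          (Fin.↑ˡ-injective (n * a) b b′ (cong proj₂ eq))

      colourBit≢rankBit : ∀ b p q → colourBit b ≢ rankBit p q
      colourBit≢rankBit b p q eq with trans (sym (Fin.splitAt-↑ˡ k b (n * a)))
        (trans (cong (splitAt k) eq) (Fin.splitAt-↑ʳ k (n * a) (combine p q)))
      ... | ()

      ∈-map-map⁻ : ∀ {A A′ A″ : Set} (g : A → A′) (f : A′ → A″) {y} xs →
        y ∈ List.map f (List.map g xs) → ∃ λ x → y ≡ f (g x)
      ∈-map-map⁻ g f xs y∈ with ∈-map⁻ f y∈
      ... | _ , z∈ , refl with ∈-map⁻ g z∈
      ...   | x , _ , refl = x , refl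

      sites-++ : ∀ (cs ds : List (Constraint n phaseBits)) → Unique (sites cs) → Unique (sites ds) →
        (∀ {x} → x ∈ sites cs → x ∈ sites ds → ⊥) →
        Unique (sites (cs ++ ds))
      sites-++ cs ds ucs uds disjoint = subst Unique (sym (List.map-++ proj₁ cs ds))
        (Unique.++⁺ ucs uds λ (x∈ , y∈) → disjoint x∈ y∈)

      lead-colour-disjoint : ∀ e c {x} → x ∈ sites (leadConstraints e) →
        x ∈ sites (colourConstraints c) → ⊥
      lead-colour-disjoint e c x∈ y∈
        with ∈-map-map⁻ (leadConstraint e) proj₁ (allFin j) x∈
           | ∈-map-map⁻ (colourConstraint c) proj₁ (cartesianProduct (allFin k) (allFin k)) y∈
      ... | q , refl | (s , b) , eq = colourBit≢rankBit b _ _ (sym (cong proj₂ eq))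

      single-unique : ∀ c → Unique (sites (single c))
      single-unique c = sites-++ (leadConstraints (firstArc c)) (colourConstraints c)
        (lead-unique (firstArc c)) (colour-unique-sites c) (lead-colour-disjoint (firstArc c) c)

      double-unique : ∀ c e → e ≢ firstArc c → Unique (sites (double c e))
      double-unique c e e≢ = sites-++ (leadConstraints e) (single c) (lead-unique e) (single-unique c) disjoint
        where
        disjoint : ∀ {x} → x ∈ sites (leadConstraints e) → x ∈ sites (single c) → ⊥
        disjoint x∈ y∈ with ∈-++⁻ (sites (leadConstraints (firstArc c)))
                              (subst (_ ∈_) (List.map-++ proj₁ (leadConstraints (firstArc c)) (colourConstraints c)) y∈)
        ... | inj₂ y∈′ = lead-colour-disjoint e c x∈ y∈′
        ... | inj₁ y∈′
          with ∈-map-map⁻ (leadConstraint e) proj₁ (allFin j) x∈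
             | ∈-map-map⁻ (leadConstraint (firstArc c)) proj₁ (allFin j) y∈′
        ...   | q , refl | q′ , eq = e≢ (lead-disjoint {e} {firstArc c} {q} {q′} eq)

      length-lead : ∀ e → length (leadConstraints e) ≡ j
      length-lead e = trans (List.length-map _ (allFin j)) (List.length-tabulate {n = j} id)

      length-single : ∀ c → length (single c) ≡ j + k * k
      length-single c = trans (List.length-++ (leadConstraints (firstArc c))) (cong₂ _+_ (length-lead (firstArc c))
        (trans (List.length-map _ (cartesianProduct (allFin k) (allFin k)))
        (trans (length-cartesianProductWith _,_ (allFin k) (allFin k))
               (cong (λ x → x * x) (List.length-tabulate {n = k} id)))))

      length-double : ∀ c e → length (double c e) ≡ j + (j + k * k)
      length-double c e = trans (List.length-++ (leadConstraints e)) (cong₂ _+_ (length-lead e) (length-single c))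

      Ω : List (Vec (Vec Bool phaseBits) n)
      Ω = assignments n phaseBits

      D = (2 ^ phaseBits) ^ n

      -- The first arc is exempt: it leads as part of the event itself, and `double c (firstArc c)`
      -- would prescribe the same bits twice.
      collision : Cycle graph k → Vec (Vec Bool phaseBits) n → Arc → ℕ
      collision c α e = if does (e ≟ᴬ firstArc c) then 0 else [ α satisfies double c e ]

      ∑-single : ∀ c → 2 ^ (j + k * k) * ∑ Ω [_satisfies single c ] ≡ D
      ∑-single c = subst (λ l → 2 ^ l * ∑ Ω [_satisfies single c ] ≡ D) (length-single c)
        (∑-satisfies n phaseBits (single c) (single-unique c))

      ∑-collision : ∀ c e → 2 ^ (j + (j + k * k)) * ∑ Ω (λ α → collision c α e) ≤ D
      ∑-collision c e with e ≟ᴬ firstArc c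
      ... | yes _ = ≤-trans (≤-reflexive (trans (cong (2 ^ (j + (j + k * k)) *_)
                      (trans (∑-const Ω 0) (*-zeroʳ (length Ω)))) (*-zeroʳ (2 ^ (j + (j + k * k)))))) z≤n
      ... | no e≢ = ≤-reflexive (subst (λ l → 2 ^ l * ∑ Ω [_satisfies double c e ] ≡ D) (length-double c e)
        (∑-satisfies n phaseBits (double c e) (double-unique c e e≢)))

      detection : Vec (Vec Bool phaseBits) n → ℕ
      detection α = ⟦ does (Fin.any? (detects? α)) ⟧

      detected : ∀ α → ∃ (Detects α) → detection α ≡ 1
      detected α p = cong ⟦_⟧ (dec-true (Fin.any? (detects? α)) p)

      collision-satisfied : ∀ c α {e} → e ≢ firstArc c → Leads j (rank (lookup α (proj₁ e)) (toℕ (proj₂ e))) →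
        Satisfies (single c) α → collision c α e ≡ 1
      collision-satisfied c α {e} e≢ leads sat rewrite dec-false (e ≟ᴬ firstArc c) e≢ =
        satisfied (double c e) α (All.++⁺ (leads⇒satisfies α leads) sat)

      collisions : Cycle graph k → Vec (Vec Bool phaseBits) n → ℕ
      collisions c α = ∑ arcs (collision c α)

      module _ (0<j : 0 < j) where

        collision-free⇒detects : ∀ c α → Satisfies (single c) α → collisions c α ≡ 0 → Detects α (vertex c 0)
        collision-free⇒detects c α sat free =
          Winner.detected α j 0<j j≤a (vertex c) (adjacent c) (closed c)
            (satisfies⇒colour α c (All.++⁻ʳ (leadConstraints (firstArc c)) sat))
            (satisfies⇒leads α (All.++⁻ˡ (leadConstraints (firstArc c)) sat))
            only
          where
          only : ∀ v p → Leads j (rank (lookup α v) (toℕ p)) → (v , p) ≡ firstArc c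
          only v p leads with (v , p) ≟ᴬ firstArc c
          ... | yes eq = eq
          ... | no  e≢ = contradiction
            (≤-trans (≤-reflexive (sym (collision-satisfied c α e≢ leads sat)))
              (≤-trans (∈⇒≤∑ (collision c α) (∈-arcs (v , p))) (≤-reflexive free)))
            λ ()

        single≤ : ∀ c α → [ α satisfies single c ] ≤ detection α + collisions c α
        single≤ c α with satisfies? (single c) α
        ... | no  _   = z≤n
        ... | yes sat with collisions c α in eq
        ...   | suc x = m≤n⇒m≤o+n (detection α) (s≤s z≤n)
        ...   | zero  = ≤-reflexive (sym (trans (+-identityʳ (detection α))
                      (detected α (vertex c 0 , collision-free⇒detects c α sat eq))))

        -- If both events occur, the first arc of `c` is a second leading arc in the eyes of `c′`.
        single≤collisions : ∀ c c′ α → firstArc c ≢ firstArc c′ → 0 < [ α satisfies single c ] →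
          [ α satisfies single c′ ] ≤ collisions c′ α
        single≤collisions c c′ α c≢c′ pos with satisfies? (single c) α | satisfies? (single c′) α
        ... | yes _   | no  _    = z≤n
        ... | yes sat | yes sat′ = ≤-trans (≤-reflexive (sym (collision-satisfied c′ α c≢c′
            (satisfies⇒leads α (All.++⁻ˡ (leadConstraints (firstArc c)) sat)) sat′)))
          (∈⇒≤∑ (collision c′ α) (∈-arcs (firstArc c)))

        firstArc-sameStart : ∀ e e′ → firstArc (cyclicCycle e) ≡ firstArc (cyclicCycle e′) → SameStart e e′
        firstArc-sameStart e e′ eq = cong proj₁ eq , (begin
          vertex c 1          ≡⟨ cong proj₁ (sym (Inverse.strictlyInverseˡ (port (vertex c 0)) _)) ⟩
          head (firstArc c)   ≡⟨ cong head eq ⟩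
          head (firstArc c′)  ≡⟨ cong proj₁ (Inverse.strictlyInverseˡ (port (vertex c′ 0)) _) ⟩
          vertex c′ 1         ∎)
          where
          open ≡-Reasoning
          c = cyclicCycle e
          c′ = cyclicCycle e′
          head : Arc → Fin n
          head (v , p) = proj₁ (Inverse.to (port v) p)

        -- A Bonferroni-type inequality, outcome by outcome: the events occurring with a unique
        -- leader amount to at most one, and any other is paid for by a collision.
        ∑-single≤ : ∀ α → ∑ cyclicEdges (λ e → [ α satisfies single (cyclicCycle e) ]) ≤
                           detection α + ∑ cyclicEdges (λ e → collisions (cyclicCycle e) α)
        ∑-single≤ α = ∑-pairwise (λ e → [ α satisfies single (cyclicCycle e) ])
          (λ e → collisions (cyclicCycle e) α) (detection α)
          (AllPairs.map (λ {e} {e′} e≢ eq → e≢ (firstArc-sameStart e e′ eq)) cyclicEdges-distinct)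
          (λ e → single≤ (cyclicCycle e) α)
          (λ {e} {e′} → single≤collisions (cyclicCycle e) (cyclicCycle e′) α)

        private
          -- `Q` and `K` are the reciprocals of the chances that a given arc leads and that a given
          -- cycle is coloured consecutively.
          Q = 2 ^ j
          K = 2 ^ (k * k)
          s = length cyclicEdges
          M = length arcs
          S = ∑ Ω detection

        ∑∑-single : Q * K * ∑ Ω (λ α → ∑ cyclicEdges (λ e → [ α satisfies single (cyclicCycle e) ])) ≡ s * D
        ∑∑-single = begin
          Q * K * ∑ Ω (λ α → ∑ cyclicEdges (λ e → [ α satisfies single (cyclicCycle e) ]))
            ≡⟨ cong (Q * K *_) (∑-swap Ω cyclicEdges _) ⟩
          Q * K * ∑ cyclicEdges (λ e → ∑ Ω [_satisfies single (cyclicCycle e) ])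
            ≡⟨ ∑-*ˡ cyclicEdges (Q * K) _ ⟨
          ∑ cyclicEdges (λ e → Q * K * ∑ Ω [_satisfies single (cyclicCycle e) ])
            ≡⟨ ∑-cong cyclicEdges (λ e → trans (cong (_* ∑ Ω [_satisfies single (cyclicCycle e) ])
                 (sym (^-distribˡ-+-* 2 j (k * k)))) (∑-single (cyclicCycle e))) ⟩
          ∑ cyclicEdges (λ _ → D)
            ≡⟨ ∑-const cyclicEdges D ⟩
          s * D ∎
          where open ≡-Reasoning

        ∑-collisions : ∀ c → Q * (Q * K) * ∑ Ω (collisions c) ≤ M * D
        ∑-collisions c = begin
          Q * (Q * K) * ∑ Ω (collisions c)
            ≡⟨ cong (Q * (Q * K) *_) (∑-swap Ω arcs (collision c)) ⟩
          Q * (Q * K) * ∑ arcs (λ e → ∑ Ω (λ α → collision c α e))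
            ≡⟨ ∑-*ˡ arcs (Q * (Q * K)) _ ⟨
          ∑ arcs (λ e → Q * (Q * K) * ∑ Ω (λ α → collision c α e))
            ≤⟨ ∑-mono arcs (λ e → ≤-trans (≤-reflexive (cong (_* ∑ Ω (λ α → collision c α e)) powers)) (∑-collision c e)) ⟩
          ∑ arcs (λ _ → D)
            ≡⟨ ∑-const arcs D ⟩
          M * D ∎
          where
          open ≤-Reasoning
          powers : Q * (Q * K) ≡ 2 ^ (j + (j + k * k))
          powers = sym (trans (^-distribˡ-+-* 2 j (j + k * k)) (cong (Q *_) (^-distribˡ-+-* 2 j (k * k))))

        ∑∑-collisions : Q * (Q * K) * ∑ Ω (λ α → ∑ cyclicEdges (λ e → collisions (cyclicCycle e) α)) ≤ s * (M * D)
        ∑∑-collisions = begin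
          Q * (Q * K) * ∑ Ω (λ α → ∑ cyclicEdges (λ e → collisions (cyclicCycle e) α))
            ≡⟨ cong (Q * (Q * K) *_) (∑-swap Ω cyclicEdges _) ⟩
          Q * (Q * K) * ∑ cyclicEdges (λ e → ∑ Ω (collisions (cyclicCycle e)))
            ≡⟨ ∑-*ˡ cyclicEdges (Q * (Q * K)) _ ⟨
          ∑ cyclicEdges (λ e → Q * (Q * K) * ∑ Ω (collisions (cyclicCycle e)))
            ≤⟨ ∑-mono cyclicEdges (λ e → ∑-collisions (cyclicCycle e)) ⟩
          ∑ cyclicEdges (λ _ → M * D)
            ≡⟨ ∑-const cyclicEdges (M * D) ⟩
          s * (M * D) ∎
          where open ≤-Reasoning

        -- In probabilities: s / (Q K) ≤ S / D + s M / (Q² K), multiplied by Q² K D.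
        union-bound : Q * (s * D) ≤ Q * (Q * K) * S + s * (M * D)
        union-bound = begin
          Q * (s * D)                    ≡⟨ cong (Q *_) (sym ∑∑-single) ⟩
          Q * (Q * K * X)                ≡⟨ *-assoc Q (Q * K) X ⟨
          Q * (Q * K) * X                ≤⟨ *-monoʳ-≤ (Q * (Q * K)) (∑-mono Ω ∑-single≤) ⟩
          Q * (Q * K) * ∑ Ω (λ α → detection α + ∑ cyclicEdges (λ e → collisions (cyclicCycle e) α))
                                         ≡⟨ cong (Q * (Q * K) *_) (∑-+ Ω detection _) ⟩
          Q * (Q * K) * (S + Y)          ≡⟨ *-distribˡ-+ (Q * (Q * K)) S Y ⟩
          Q * (Q * K) * S + Q * (Q * K) * Y ≤⟨ +-monoʳ-≤ (Q * (Q * K) * S) ∑∑-collisions ⟩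
          Q * (Q * K) * S + s * (M * D)  ∎
          where
          open ≤-Reasoning
          X = ∑ Ω (λ α → ∑ cyclicEdges (λ e → [ α satisfies single (cyclicCycle e) ]))
          Y = ∑ Ω (λ α → ∑ cyclicEdges (λ e → collisions (cyclicCycle e) α))

        -- With 2 M ≤ Q ≤ 4 M, an arc has Q⁻¹ ≥ (4 M)⁻¹ chance to lead, and at
        -- most half of it is lost to collisions with the other arcs.
        detection-bound : 2 * M ≤ Q → Q ≤ 4 * M → s * D ≤ 8 * M * K * S
        detection-bound 2M≤Q Q≤4M = begin
          s * D            ≤⟨ *-cancelˡ-≤ Q {{m^n≢0 2 j}} (+-cancelʳ-≤ (Q * (s * D)) _ _ halved) ⟩
          2 * Q * K * S    ≤⟨ *-monoˡ-≤ S (*-monoˡ-≤ K (*-monoʳ-≤ 2 Q≤4M)) ⟩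
          2 * (4 * M) * K * S ≡⟨ cong (λ x → x * K * S) (sym (*-assoc 2 4 M)) ⟩
          8 * M * K * S    ∎
          where
          open ≤-Reasoning
          double-Q : ∀ Q s D → Q * (s * D) + Q * (s * D) ≡ 2 * (Q * (s * D))
          double-Q = solve-∀
          expand : ∀ Q K S s M D → 2 * (Q * (Q * K) * S + s * (M * D)) ≡ Q * (2 * Q * K * S) + 2 * M * (s * D)
          expand = solve-∀
          halved : Q * (s * D) + Q * (s * D) ≤ Q * (2 * Q * K * S) + Q * (s * D)
          halved = begin
            Q * (s * D) + Q * (s * D)                ≡⟨ double-Q Q s D ⟩
            2 * (Q * (s * D))                        ≤⟨ *-monoʳ-≤ 2 union-bound ⟩
            2 * (Q * (Q * K) * S + s * (M * D))      ≡⟨ expand Q K S s M D ⟩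
            Q * (2 * Q * K * S) + 2 * M * (s * D)    ≤⟨ +-monoʳ-≤ (Q * (2 * Q * K * S)) (*-monoˡ-≤ (s * D) 2M≤Q) ⟩
            Q * (2 * Q * K * S) + Q * (s * D)        ∎

-- Amplification and round complexity

n≤2^⌈log₂n⌉ : ∀ n → n ≤ 2 ^ ⌈log₂ n ⌉
n≤2^⌈log₂n⌉ n = bound n (<-wellFounded n)
  where
  bound : ∀ n (rs : Acc _<_ n) → n ≤ 2 ^ ⌈log2⌉ n rs
  bound 0             _        = z≤n
  bound 1             _        = ≤-refl
  bound (suc (suc n)) (acc rs) = begin
    2 + n                             ≤⟨ +-monoʳ-≤ 2 (≤-reflexive (sym (⌊n/2⌋+⌈n/2⌉≡n n))) ⟩
    2 + (⌊ n /2⌋ + ⌈ n /2⌉)           ≤⟨ +-monoʳ-≤ 2 (+-monoˡ-≤ ⌈ n /2⌉ (⌊n/2⌋≤⌈n/2⌉ n)) ⟩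
    2 + (⌈ n /2⌉ + ⌈ n /2⌉)           ≡⟨ double ⌈ n /2⌉ ⟩
    2 * suc ⌈ n /2⌉                   ≤⟨ *-monoʳ-≤ 2 (bound (suc ⌈ n /2⌉) _) ⟩
    2 ^ ⌈log2⌉ (suc (suc n)) (acc rs) ∎
    where
    open ≤-Reasoning
    double : ∀ x → 2 + (x + x) ≡ 2 * suc x
    double = solve-∀

power-between : ∀ x → 0 < x → ∃ λ j → x ≤ 2 ^ j × 2 ^ j ≤ 2 * x
power-between 1             _ = 0 , ≤-refl , s≤s z≤n
power-between (suc (suc x)) _ with power-between (suc x) z<s
... | j , x<2^j , 2^j≤2x with suc (suc x) ≤? 2 ^ j
...   | yes le = j , le , ≤-trans 2^j≤2x (*-monoʳ-≤ 2 (n≤1+n (suc x)))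
-- Only `2 ^ j ≡ suc x` remains; this power is one too small, and its double fits.
...   | no  ≰ with eq ← ≤-antisym x<2^j (s≤s⁻¹ (≰⇒> ≰)) =
  suc j , subst (λ y → suc (suc x) ≤ 2 * y) eq (subst (suc (suc x) ≤_) (sym (grow x)) (m≤m+n _ x))
        , *-monoʳ-≤ 2 (≤-trans (≤-reflexive (sym eq)) (n≤1+n (suc x)))
  where
  grow : ∀ x → 2 * suc x ≡ suc (suc x) + x
  grow = solve-∀

2^-cancel-≤ : ∀ i j → 2 ^ i ≤ 2 ^ j → i ≤ j
2^-cancel-≤ i j le = ≮⇒≥ λ j<i → <⇒≱ (^-monoʳ-< 2 (n<1+n 1) j<i) le

all-true : ∀ (p : A → Bool) xs → (∀ x → p x ≡ true) → all p xs ≡ true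
all-true p []       eq = refl
all-true p (x ∷ xs) eq rewrite eq x = all-true p xs eq

any-not-false : ∀ (p : A → Bool) xs → any (not ∘ p) xs ≡ false → ∀ {x} → x ∈ xs → p x ≡ true
any-not-false p (x ∷ xs) eq x∈ with p x in px
any-not-false p (x ∷ xs) eq (here refl) | true = px
any-not-false p (x ∷ xs) eq (there x∈)  | true = any-not-false p xs eq x∈

-- Rational inequalities cross-multiplied into ℕ

pos-*≤ : ∀ a b c d → + a ℤ.* + b ℤ.≤ + c ℤ.* + d → a * b ≤ c * d
pos-*≤ a b c d le =
  ℤ.drop‿+≤+ (subst₂ ℤ._≤_ (sym (ℤ.pos-* a b)) (sym (ℤ.pos-* c d)) le)

≤pos-* : ∀ a b c d → a * b ≤ c * d → + a ℤ.* + b ℤ.≤ + c ℤ.* + d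
≤pos-* a b c d le = subst₂ ℤ._≤_ (ℤ.pos-* a b) (ℤ.pos-* c d) (ℤ.+≤+ le)

scale-≃ : ∀ p q .(c : Coprime p (suc q)) x → toℚᵘ (mkℚ (+ p) q c ℚ.* fromℕ x) ℚᵘ.≃ mkℚᵘ (+ (p * x)) q
scale-≃ p q c x = ℚᵘ.≃-trans (ℚ.toℚᵘ-homo-* (mkℚ (+ p) q c) (fromℕ x))
  (ℚᵘ.≃-trans (ℚᵘ.*-congˡ {mkℚᵘ (+ p) q} (ℚ.toℚᵘ-fromℚᵘ (mkℚᵘ (+ x) 0)))
    (ℚᵘ.*≡* (cong₂ ℤ._*_ (sym (ℤ.pos-* p x)) (cong (+_ ∘ suc) (sym (*-identityʳ q))))))

scale≤⇒ : ∀ p q .(c : Coprime p (suc q)) x y → mkℚ (+ p) q c ℚ.* fromℕ x ℚ.≤ fromℕ y → p * x ≤ y * suc q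
scale≤⇒ p q c x y le
  with ℚᵘ.*≤* le′ ← ℚᵘ.≤-respˡ-≃ (scale-≃ p q c x)
                      (ℚᵘ.≤-respʳ-≃ (ℚ.toℚᵘ-fromℚᵘ (mkℚᵘ (+ y) 0)) (ℚ.toℚᵘ-mono-≤ le)) =
  subst (_≤ y * suc q) (*-identityʳ (p * x)) (pos-*≤ (p * x) 1 y (suc q) le′)

scale≤⇐ : ∀ p q .(c : Coprime p (suc q)) x y → p * x ≤ y * suc q → mkℚ (+ p) q c ℚ.* fromℕ x ℚ.≤ fromℕ y
scale≤⇐ p q c x y le = ℚ.toℚᵘ-cancel-≤ (ℚᵘ.≤-respˡ-≃ (ℚᵘ.≃-sym (scale-≃ p q c x))
  (ℚᵘ.≤-respʳ-≃ (ℚᵘ.≃-sym (ℚ.toℚᵘ-fromℚᵘ (mkℚᵘ (+ y) 0)))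
    (ℚᵘ.*≤* (≤pos-* (p * x) 1 y (suc q) (subst (_≤ y * suc q) (sym (*-identityʳ (p * x))) le)))))

2/3≤ : ∀ x d .{{_ : NonZero d}} → 2 * d ≤ 3 * x → + 2 ℚ./ 3 ℚ.≤ + x ℚ./ d
2/3≤ x (suc d) le = ℚ.toℚᵘ-cancel-≤ (ℚᵘ.≤-respˡ-≃ (ℚᵘ.≃-sym (ℚ.toℚᵘ-fromℚᵘ (mkℚᵘ (+ 2) 2)))
  (ℚᵘ.≤-respʳ-≃ (ℚᵘ.≃-sym (ℚ.toℚᵘ-fromℚᵘ (mkℚᵘ (+ x) d)))
    (ℚᵘ.*≤* (≤pos-* 2 (suc d) x 3 (subst (2 * suc d ≤_) (*-comm 3 x) le)))))

d/d≡1 : ∀ x d .{{_ : NonZero d}} → x ≡ d → + x ℚ./ d ≡ 1ℚ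
d/d≡1 x (suc d) refl = ℚ.fromℚᵘ-cong {mkℚᵘ (+ suc d) d} {mkℚᵘ (+ 1) 0} (ℚᵘ.*≡* (ℤ.*-comm (+ suc d) (+ 1)))

-- Exceeds 2 K / ε: if a phase detects with probability at least ε / K, the expected number of
-- detecting phases is at least 2, as `amplification` demands. The last clause concerns ε ≤ 0,
-- outside the range of the theorem.
phases : ℕ → ℚ → ℕ
phases K (mkℚ (+ suc p) q _) = suc (2 * (K * suc q) / suc p)
phases K _                   = 0

-- The extra phase from rounding up costs at most 1 / ε because ε ≤ 1; hence 2 K + 1.
phases-upper : ∀ K p q → suc p ≤ suc q → suc (2 * (K * suc q) / suc p) * suc p ≤ (2 * K + 1) * suc q
phases-upper K p q p≤q = begin
  suc p + 2 * (K * suc q) / suc p * suc p ≤⟨ +-mono-≤ p≤q (m/n*n≤m (2 * (K * suc q)) (suc p)) ⟩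
  suc q + 2 * (K * suc q)                 ≡⟨ collect K (suc q) ⟩
  (2 * K + 1) * suc q                     ∎
  where
  open ≤-Reasoning
  collect : ∀ K q → q + 2 * (K * q) ≡ (2 * K + 1) * q
  collect = solve-∀

phases-lower : ∀ K p q → 2 * (K * suc q) ≤ suc (2 * (K * suc q) / suc p) * suc p
phases-lower K p q = begin
  x                              ≡⟨ m≡m%n+[m/n]*n x (suc p) ⟩
  x % suc p + x / suc p * suc p  ≤⟨ +-monoˡ-≤ (x / suc p * suc p) (<⇒≤ (m%n<n x (suc p))) ⟩
  suc p + x / suc p * suc p      ∎
  where
  open ≤-Reasoning
  x = 2 * (K * suc q)

-- For n ≤ 1 the logarithm is 0 and messages carry no bits. Contrapositively, the presence of an
-- edge yields L > 0.
∣E∣≡0 : ∀ {n} (G : Graph n) → n ≤ 1 → ∣E∣ G ≡ 0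
∣E∣≡0 {0} G _ = refl
∣E∣≡0 {1} G _ = refl
∣E∣≡0 {suc (suc _)} G (s≤s ())

-- A phase detects a cycle with probability at least ε / odds k.
odds : ℕ → ℕ
odds k = 16 * 2 ^ (k * k)

module Testing (k′ n a m W : ℕ) .(fits : a + m ≤ W) (2<k : 2 < suc k′) (T : ℕ) (N : Network m n) where

  open CycleTester k′ n a m W fits
  open OnNetwork N
  open Run T
  open Execution (tester T) N
  open Network N
  open Counting k′ n a m W fits N

  total : ℕ
  total = (2 ^ (T * phaseBits)) ^ n

  total≢0 : NonZero total
  total≢0 = m^n≢0 (2 ^ (T * phaseBits)) n {{m^n≢0 2 (T * phaseBits)}}

  free⇒allAccept : (cycle k 2<k -Free) graph → ∀ ω → allAccept ω ≡ true
  free⇒allAccept free ω = all-true (nodeAccepts ω) (allFin n) λ v → trans (nodeAccepts≡ ω v)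
    (cong not (rejectedBefore-false ω v T λ t _ found → free (detects⇒cycle (phaseOf t ω) 2<k found)))

  free⇒Pr≡1 : (cycle k 2<k -Free) graph → Pr allAccept ≡ 1ℚ
  free⇒Pr≡1 free = d/d≡1 (length (filterᵇ allAccept allCoins)) total {{total≢0}} (begin
    length (filterᵇ allAccept allCoins)   ≡⟨ ∑-filterᵇ allAccept allCoins ⟨
    ∑ allCoins (λ ω → ⟦ allAccept ω ⟧)    ≡⟨ ∑-cong allCoins (λ ω → cong ⟦_⟧ (free⇒allAccept free ω)) ⟩
    ∑ allCoins (λ _ → 1)                  ≡⟨ ∑-const allCoins 1 ⟩
    length allCoins * 1                   ≡⟨ *-identityʳ _ ⟩
    length allCoins                       ≡⟨ length-assignments n (T * phaseBits) ⟩
    total                                 ∎)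
    where open ≡-Reasoning

  detectsAny : Vec (Vec Bool phaseBits) n → Bool
  detectsAny α = does (Fin.any? (detects? α))

  quiet : Vec (Vec Bool phaseBits) n → ℕ
  quiet α = ⟦ not (detectsAny α) ⟧

  ⟦not⟧+⟦⟧ : ∀ b → ⟦ not b ⟧ + ⟦ b ⟧ ≡ 1
  ⟦not⟧+⟦⟧ true  = refl
  ⟦not⟧+⟦⟧ false = refl

  ∑-complement : ∀ (xs : List A) (p : A → Bool) → ∑ xs (λ x → ⟦ not (p x) ⟧) + ∑ xs (λ x → ⟦ p x ⟧) ≡ length xs
  ∑-complement xs p = trans (sym (∑-+ xs _ _))
    (trans (∑-cong xs (λ x → ⟦not⟧+⟦⟧ (p x))) (trans (∑-const xs 1) (*-identityʳ _)))

  silent≤∏ : ∀ ω → ⟦ not (someRejects ω) ⟧ ≤ ∏-blocks T phaseBits quiet ω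
  silent≤∏ ω with someRejects ω in eq
  ... | true  = z≤n
  ... | false = ≤-reflexive (sym (∏-blocks≡1 T phaseBits quiet ω λ t t<T →
    cong (⟦_⟧ ∘ not) (dec-false (Fin.any? (detects? (phaseOf t ω))) λ (v , found) →
      contradiction
        (trans (sym (any-not-false (nodeAccepts ω) (allFin n) eq (∈-allFin v)))
          (trans (nodeAccepts≡ ω v) (cong not (rejectedBefore-true ω v T t t<T found))))
        λ ())))

  D′ S F : ℕ
  D′ = (2 ^ phaseBits) ^ n
  S  = ∑ (assignments n phaseBits) (λ α → ⟦ detectsAny α ⟧)
  F  = ∑ (assignments n phaseBits) quiet

  F+S≡D : F + S ≡ D′
  F+S≡D = trans (∑-complement (assignments n phaseBits) detectsAny) (length-assignments n phaseBits)

  D^T≡total : D′ ^ T ≡ total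
  D^T≡total = begin
    ((2 ^ phaseBits) ^ n) ^ T    ≡⟨ cong (_^ T) (^-*-assoc 2 phaseBits n) ⟩
    (2 ^ (phaseBits * n)) ^ T    ≡⟨ ^-*-assoc 2 (phaseBits * n) T ⟩
    2 ^ (phaseBits * n * T)      ≡⟨ cong (2 ^_) (shuffle phaseBits n T) ⟩
    2 ^ (T * phaseBits * n)      ≡⟨ ^-*-assoc 2 (T * phaseBits) n ⟨
    (2 ^ (T * phaseBits)) ^ n    ∎
    where
    open ≡-Reasoning
    shuffle : ∀ x y z → x * y * z ≡ z * x * y
    shuffle = solve-∀

  Pr-someRejects : 2 * D′ ≤ T * S → + 2 ℚ./ 3 ℚ.≤ Pr someRejects
  Pr-someRejects enough = 2/3≤ rejecting total {{total≢0}} (+-cancelˡ-≤ total (2 * total) (3 * rejecting) (begin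
    total + 2 * total            ≡⟨ cong (3 *_) (sym complement) ⟩
    3 * (silent + rejecting)     ≡⟨ *-distribˡ-+ 3 silent rejecting ⟩
    3 * silent + 3 * rejecting   ≤⟨ +-monoˡ-≤ (3 * rejecting) few ⟩
    total + 3 * rejecting        ∎))
    where
    open ≤-Reasoning
    rejecting = length (filterᵇ someRejects allCoins)
    silent = ∑ allCoins (λ ω → ⟦ not (someRejects ω) ⟧)
    complement : silent + rejecting ≡ total
    complement = trans (cong (λ x → silent + x) (sym (∑-filterᵇ someRejects allCoins)))
      (trans (∑-complement allCoins someRejects) (length-assignments n (T * phaseBits)))
    F+S≢0 : NonZero (F + S)
    F+S≢0 = subst NonZero (sym F+S≡D) (m^n≢0 (2 ^ phaseBits) n {{m^n≢0 2 phaseBits}})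
    few : 3 * silent ≤ total
    few = begin
      3 * silent                                        ≤⟨ *-monoʳ-≤ 3 (∑-mono allCoins silent≤∏) ⟩
      3 * ∑ allCoins (∏-blocks T phaseBits quiet)       ≡⟨ cong (3 *_) (∑-∏-blocks n T phaseBits quiet) ⟩
      3 * F ^ T   ≤⟨ amplification F S T {{F+S≢0}} (subst (λ x → 2 * x ≤ T * S) (sym F+S≡D) enough) ⟩
      (F + S) ^ T                                       ≡⟨ cong (_^ T) F+S≡D ⟩
      D′ ^ T                                            ≡⟨ D^T≡total ⟩
      total                                             ∎

  open CycleEdges graph (suc k′) 2<k

  -- With ε = (p + 1) / (q + 1) and e = `∣E∣ graph`, a phase detects with probability at least s /
  -- (8 M 2 ^ (k * k)), where M = 2 e and s ≥ ε e, that is, at least ε / odds k. This is where `j`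
  -- is chosen.
  enough-phases : ∀ L p q → n ≤ 2 ^ L → 5 * L ≤ a → 0 < ∣E∣ graph →
    suc p * ∣E∣ graph ≤ ∣E∣ (graph △ withoutCycles) * suc q →
    2 * (odds k * suc q) ≤ T * suc p → 2 * D′ ≤ T * S
  enough-phases L p q n≤2^L 5L≤a 0<E far long with power-between (2 * length arcs) 0<2M
    where
    0<2M : 0 < 2 * length arcs
    0<2M = *-mono-< {0} {2} {0} z<s (subst (0 <_) (sym length-arcs) (m≤n⇒m≤n+o _ 0<E))
  ... | j , 2M≤2^j , 2^j≤4M = *-cancelˡ-≤ (suc p) (begin
    suc p * (2 * D′)             ≡⟨ swap₁ (suc p) D′ ⟩
    2 * (suc p * D′)             ≤⟨ *-monoʳ-≤ 2 (*-cancelˡ-≤ e {{>-nonZero 0<E}} single-phase) ⟩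
    2 * (suc q * odds k * S)          ≡⟨ swap₂ (suc q) (odds k) S ⟩
    2 * (odds k * suc q) * S          ≤⟨ *-monoˡ-≤ S long ⟩
    T * suc p * S                ≡⟨ swap₃ T (suc p) S ⟩
    suc p * (T * S)              ∎)
    where
    open ≤-Reasoning
    e = ∣E∣ graph
    0<L : ∀ L → n ≤ 2 ^ L → 0 < L
    0<L zero    n≤1 = contradiction (∣E∣≡0 graph n≤1) (m<n⇒n≢0 0<E)
    0<L (suc L) _   = z<s
    0<j : ∀ j → 2 * length arcs ≤ 2 ^ j → 0 < j
    0<j zero    2M≤1 = contradiction (≤-trans (*-monoʳ-≤ 2 (subst (1 ≤_) (sym length-arcs) (m≤n⇒m≤n+o _ 0<E))) 2M≤1) λ { (s≤s ()) }
    0<j (suc j) _    = z<s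
    -- The 3 comes from the factor 8 = 2 ^ 3 and is absorbed into 3 L, as L ≥ 1.
    exponent : 3 + (L + L) ≤ 5 * L
    exponent = ≤-trans (+-monoˡ-≤ (L + L) (*-monoʳ-≤ 3 (0<L L n≤2^L))) (≤-reflexive (five L))
      where
      five : ∀ L → 3 * L + (L + L) ≡ 5 * L
      five = solve-∀
    j≤a : j ≤ a
    j≤a = 2^-cancel-≤ j a (begin
      2 ^ j                      ≤⟨ 2^j≤4M ⟩
      2 * (2 * length arcs)      ≡⟨ cong (λ M → 2 * (2 * M)) length-arcs ⟩
      2 * (2 * (e + e))          ≡⟨ eight e ⟩
      8 * e                      ≤⟨ *-monoʳ-≤ 8 (∣E∣≤n*n graph) ⟩
      8 * (n * n)                ≤⟨ *-monoʳ-≤ 8 (*-mono-≤ n≤2^L n≤2^L) ⟩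
      2 ^ 3 * (2 ^ L * 2 ^ L)    ≡⟨ cong (2 ^ 3 *_) (^-distribˡ-+-* 2 L L) ⟨
      2 ^ 3 * 2 ^ (L + L)        ≡⟨ ^-distribˡ-+-* 2 3 (L + L) ⟨
      2 ^ (3 + (L + L))          ≤⟨ ^-monoʳ-≤ 2 (≤-trans exponent 5L≤a) ⟩
      2 ^ a                      ∎)
      where
      eight : ∀ e → 2 * (2 * (e + e)) ≡ 8 * e
      eight = solve-∀
    s = length cyclicEdges
    single-phase : e * (suc p * D′) ≤ e * (suc q * odds k * S)
    single-phase = begin
      e * (suc p * D′)           ≡⟨ swap₄ e (suc p) D′ ⟩
      suc p * e * D′             ≤⟨ *-monoˡ-≤ D′ (subst (λ s → suc p * e ≤ s * suc q) (sym length-cyclicEdges) far) ⟩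
      s * suc q * D′             ≡⟨ swap₅ s (suc q) D′ ⟩
      suc q * (s * D′)           ≤⟨ *-monoʳ-≤ (suc q) (detection-bound j≤a 2<k (0<j j 2M≤2^j) 2M≤2^j
                                      (≤-trans 2^j≤4M (≤-reflexive (sym (*-assoc 2 2 (length arcs)))))) ⟩
      suc q * (8 * length arcs * 2 ^ (k * k) * S) ≡⟨ cong (λ M → suc q * (8 * M * 2 ^ (k * k) * S)) length-arcs ⟩
      suc q * (8 * (e + e) * 2 ^ (k * k) * S)     ≡⟨ swap₆ e (suc q) (2 ^ (k * k)) S ⟩
      e * (suc q * odds k * S)        ∎
      where
      swap₄ : ∀ x y z → x * (y * z) ≡ y * x * z
      swap₄ = solve-∀
      swap₅ : ∀ x y z → x * y * z ≡ y * (x * z)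
      swap₅ = solve-∀
      swap₆ : ∀ e q P S → q * (8 * (e + e) * P * S) ≡ e * (q * (16 * P) * S)
      swap₆ = solve-∀
    swap₁ : ∀ x y → x * (2 * y) ≡ 2 * (x * y)
    swap₁ = solve-∀
    swap₂ : ∀ x y z → 2 * (x * y * z) ≡ 2 * (y * x) * z
    swap₂ = solve-∀
    swap₃ : ∀ x y z → x * y * z ≡ y * (x * z)
    swap₃ = solve-∀

theorem3p1 : ∀ (k : ℕ) (2<k : 2 < k) →
    Σ ℕ λ C → ∀ (c : ℕ) →
    Σ ℕ λ b → Σ (CongestAlgorithm c b) λ A →
    TestsFreeness (cycle k 2<k) A × OneSided (cycle k 2<k) A × RunsWithin C A
-- At most (2 K + 1) / ε phases of k rounds each. The bandwidth factor adds 5 for the rank to `c`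
-- for the identifier, while the round bound does not involve `c`.
theorem3p1 (suc k′) 2<k = (2 * K + 1) * suc k′ , λ c → 5 + c , algorithm c , tests c , oneSided c , fast c
  where
  K = odds (suc k′)

  fits : ∀ c L → 5 * L + c * L ≤ (5 + c) * L
  fits c L = ≤-reflexive (sym (*-distribʳ-+ L 5 c))

  -- Ranks of 5 L bits have room for the j zeros: 2 ^ j ≤ 8∣E∣ ≤ 8n² ≤ 2 ^ (5 L).
  algorithm : ∀ c → CongestAlgorithm c (5 + c)
  algorithm c = record
    { program = λ ε n → let L = ⌈log₂ n ⌉ in
        CycleTester.tester k′ n (5 * L) (c * L) ((5 + c) * L) (fits c L) (phases K ε) }

  oneSided : ∀ c → OneSided (cycle (suc k′) 2<k) (algorithm c)
  oneSided c ε _ _ n N = Testing.free⇒Pr≡1 k′ n _ _ _ (fits c ⌈log₂ n ⌉) 2<k (phases K ε) N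

  tests : ∀ c → TestsFreeness (cycle (suc k′) 2<k) (algorithm c)
  tests c ε@(mkℚ (+ suc p) q coprime) 0<ε ε≤1 n N =
    (λ free → subst (+ 2 ℚ./ 3 ℚ.≤_) (sym (oneSided c ε 0<ε ε≤1 n N free)) (2/3≤ 1 1 (s≤s (s≤s z≤n)))) ,
    λ 0<E far → Pr-someRejects (enough-phases L p q (n≤2^⌈log₂n⌉ n) ≤-refl 0<E
      (scale≤⇒ (suc p) q coprime (∣E∣ (Network.graph N)) (∣E∣ (Network.graph N △ withoutCycles)) (far withoutCycles withoutCycles-free)) (phases-lower K p q))
    where
    L = ⌈log₂ n ⌉
    open Testing k′ n (5 * L) (c * L) ((5 + c) * L) (fits c L) 2<k (phases K ε) N using (Pr-someRejects; enough-phases)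
    open CycleEdges (Network.graph N) (suc k′) 2<k
  tests c (mkℚ (+ zero) q coprime) (ℚ.*<* (ℤ.+<+ ()))
  tests c (mkℚ ℤ.-[1+ p ] q coprime) (ℚ.*<* ())

  fast : ∀ c → RunsWithin ((2 * K + 1) * suc k′) (algorithm c)
  fast c (mkℚ (+ suc p) q coprime) 0<ε (ℚ.*≤* ε≤1) n =
    subst (ℚ._≤ fromℕ ((2 * K + 1) * suc k′)) (ℚ.*-comm (mkℚ (+ suc p) q coprime) (fromℕ (t * suc k′)))
      (scale≤⇐ (suc p) q coprime (t * suc k′) ((2 * K + 1) * suc k′) (begin
        suc p * (t * suc k′)             ≡⟨ rotate (suc p) t (suc k′) ⟩
        t * suc p * suc k′               ≤⟨ *-monoˡ-≤ (suc k′) (phases-upper K p q p≤q) ⟩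
        (2 * K + 1) * suc q * suc k′     ≡⟨ swap (2 * K + 1) (suc q) (suc k′) ⟩
        (2 * K + 1) * suc k′ * suc q     ∎))
    where
    open ≤-Reasoning
    t = phases K (mkℚ (+ suc p) q coprime)
    p≤q : suc p ≤ suc q
    p≤q = subst₂ _≤_ (*-identityʳ (suc p)) (*-identityˡ (suc q)) (pos-*≤ (suc p) 1 1 (suc q) ε≤1)
    rotate : ∀ x y z → x * (y * z) ≡ y * x * z
    rotate = solve-∀
    swap : ∀ x y z → x * y * z ≡ x * z * y
    swap = solve-∀
  fast c (mkℚ (+ zero) q coprime) (ℚ.*<* (ℤ.+<+ ()))
  fast c (mkℚ ℤ.-[1+ p ] q coprime) (ℚ.*<* ())
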